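{- Every type of $\mathrm{SCI}$ is a definable retract of $\mathtt{nat}$. That is, for every type $A$ of $\mathrm{SCI}$ there are terms $x:A\vdash\mathtt{in}:\mathtt{nat}$ and $y:\mathtt{nat}\vdash\mathtt{out}:A$ of $\mathrm{SCI}_{\mathtt{mk},\mathtt{ran}}$ whose denotations, viewed as morphisms $[\![\mathtt{in}]\!]:(\alpha A)^*\to\mathbb N^*$ and $[\![\mathtt{out}]\!]:\mathbb N^*\to(\alpha A)^*$ of $\mathbf{MonRel}$, satisfy: $[\![\mathtt{in}]\!]$ followed by $[\![\mathtt{out}]\!]$ is the identity on $(\alpha A)^*$.
   Context: **The language SCI.** Types: $A::=\mathtt{nat}\mid\mathtt{comm}\mid\mathtt{var}\mid A\multimap A$ (the first three are the base types). Terms: $M::=n\mid M\odot M\mid\mathtt{skip}\mid M;M\mid M:=M\mid\,!M\mid\mathtt{while}\ M\ \mathtt{do}\ M\mid\mathtt{ifzero}\ M\ \mathtt{then}\ M\ \mathtt{else}\ M\mid x\mid\lambda x^A.M\mid MM\mid\mathtt{new}\ x\ \mathtt{in}\ M$, where $n\in\mathbb N$, $x$ is an identifier, and $\odot$ ranges over a fixed collection of arithmetic operations on $\mathbb N$ including $+$ and (truncated) $-$. Terms are taken up to $\alpha$-equivalence ($\lambda x$ and $\mathtt{new}\ x$ bind $x$). A context $\Gamma$ is a list $x_1:A_1,\dots,x_n:A_n$ with distinct identifiers. **Typing** (all judgments must be well-formed, so $\Gamma,\Delta$ have disjoint identifiers in the application rule): $x:A\vdash x:A$; if $\Gamma,x:A\vdash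 M:B$ then $\Gamma\vdash\lambda x^A.M:A\multimap B$; if $\Gamma\vdash M:A\multimap B$ and $\Delta\vdash N:A$ then $\Gamma,\Delta\vdash MN:B$; weakening (from $\Gamma\vdash M:B$ infer $\Gamma,x:A\vdash M:B$); exchange (permuting $\Gamma$); $\vdash n:\mathtt{nat}$; $\vdash\mathtt{skip}:\mathtt{comm}$; and, with the same $\Gamma$ in all premises and conclusion: $M\odot N:\mathtt{nat}$ if $M,N:\mathtt{nat}$; $M;N:B$ if $M:\mathtt{comm}$, $N:B$, $B$ a base type; $M:=N:\mathtt{comm}$ if $M:\mathtt{var}$, $N:\mathtt{nat}$; $!M:\mathtt{nat}$ if $M:\mathtt{var}$; $\mathtt{while}\ M\ \mathtt{do}\ N:\mathtt{comm}$ if $M:\mathtt{nat}$, $N:\mathtt{comm}$; $\mathtt{ifzero}\ M\ \mathtt{then}\ N_1\ \mathtt{else}\ N_2:B$ if $M:\mathtt{nat}$, $N_1,N_2:B$, $B$ a base type; and $\Gamma\vdash\mathtt{new}\ x\ \mathtt{in}\ M:B$ if $\Gamma,x:\mathtt{var}\vdash M:B$ with $B\in\{\mathtt{comm},\mathtt{nat}\}$. **Extension.** $\mathrm{SCI}_{\mathtt{mk},\mathtt{ran}}$ is SCI plus: $\Gamma\vdash\mathtt{random}:\mathtt{nat}$; and $\Gamma\vdash\mathtt{mkvar}\ M\ N:\mathtt{var}$ if $\Gamma\vdash M:\mathtt{nat}\multimap\mathtt{comm}$ and $\Gamma\vdash N:\mathtt{nat}$. **Denotational semantics.** Put $\alpha\mathtt{nat}=\mathbb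 N$, $\alpha\mathtt{comm}=\{*\}$, $\alpha\mathtt{var}=\{\mathsf{read}(n),\mathsf{write}(n)\mid n\in\mathbb N\}$, $\alpha(A\multimap B)=(\alpha A)^*\times\alpha B$; $X^*$ is the free monoid of finite sequences, $\varepsilon$ the empty sequence. For $\Gamma=x_1:A_1,\dots,x_n:A_n$, $[\![\Gamma\vdash M:B]\!]\subseteq(\alpha A_1)^*\times\cdots\times(\alpha A_n)^*\times\alpha B$; elements are written $(\vec s,b)$, and $\vec s\,\vec s'$ is componentwise concatenation. Clauses: $[\![x:A\vdash x:A]\!]=\{(a,a)\mid a\in\alpha A\}$; $[\![\lambda x^A.M]\!]=\{(\vec s,(s,b))\mid(\vec s,s,b)\in[\![M]\!]\}$; $[\![MN]\!]=\{(\vec s,\vec t^{\,1}\cdots\vec t^{\,k},b)\mid\exists a_1,\dots,a_k.\ (\vec s,(a_1\cdots a_k,b))\in[\![M]\!],\ (\vec t^{\,i},a_i)\in[\![N]\!]\ (1\le i\le k)\}$; weakening inserts $\varepsilon$ for the new identifier; exchange permutes components; $[\![n]\!]=\{n\}$; $[\![\mathtt{skip}]\!]=\{*\}$; $[\![M_1\odot M_2]\!]=\{(\vec s\,\vec s',m_1\odot m_2)\mid(\vec s,m_1)\in[\![M_1]\!],(\vec s',m_2)\in[\![M_2]\!]\}$; $[\![M;N]\!]=\{(\vec s\,\vec s',b)\mid(\vec s,*)\in[\![M]\!],(\vec s',b)\in[\![N]\!]\}$; $[\![M:=N]\!]=\{(\vec s\,\vec s',*)\mid\exists n.\,(\vec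 s,n)\in[\![N]\!],(\vec s',\mathsf{write}(n))\in[\![M]\!]\}$; $[\![!M]\!]=\{(\vec s,n)\mid(\vec s,\mathsf{read}(n))\in[\![M]\!]\}$; $[\![\mathtt{while}\ M\ \mathtt{do}\ N]\!]=\{(\vec s^{\,1}\vec t^{\,1}\cdots\vec s^{\,j}\vec t^{\,j}\vec s,*)\mid j\ge0,\ \forall i.\,(\vec s^{\,i},0)\in[\![M]\!]\wedge(\vec t^{\,i},*)\in[\![N]\!],\ \exists m\ne0.\,(\vec s,m)\in[\![M]\!]\}$; $[\![\mathtt{ifzero}\ M\ \mathtt{then}\ N_1\ \mathtt{else}\ N_2]\!]=\{(\vec s\,\vec t,b)\mid(\vec s,0)\in[\![M]\!],(\vec t,b)\in[\![N_1]\!]\}\cup\{(\vec s\,\vec t,b)\mid\exists m\ne0.\,(\vec s,m)\in[\![M]\!],(\vec t,b)\in[\![N_2]\!]\}$; $[\![\mathtt{new}\ x\ \mathtt{in}\ M]\!]=\{(\vec s,b)\mid\exists s.\,(\vec s,s,b)\in[\![M]\!],\ s\text{ a cell trace}\}$, where $s\in(\alpha\mathtt{var})^*$ is a cell trace iff every $\mathsf{read}(n)$ in $s$ carries the value of the most recent preceding $\mathsf{write}$, or $0$ if there is none; $[\![\mathtt{random}]\!]=\{(\vec\varepsilon,n)\mid n\in\mathbb N\}$; $[\![\mathtt{mkvar}\ M\ N]\!]=\{(\vec s,\mathsf{write}(n))\mid(\vec s,*)\in[\![Mn]\!]\}\cup\{(\vec s,\mathsf{read}(n))\mid(\vec s,n)\in[\![N]\!]\}$.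 **MonRel.** Objects are monoids; morphisms $P\to Q$ are relations $R\subseteq P\times Q$ with $e_P\,R\,e_Q$; $a_iRb_i$ ($i=1,2$) implies $a_1a_2\,R\,b_1b_2$; $a\,R\,e_Q$ implies $a=e_P$; $a\,R\,b_1b_2$ implies $a=a_1a_2$ for some $a_i$ with $a_iRb_i$. Composition is relational. A morphism into a free monoid $X^*$ is determined by its restriction to $P\times X$, which may be arbitrary, so $[\![x:A\vdash M:B]\!]$ is the same thing as a $\mathbf{MonRel}$-morphism $(\alpha A)^*\to(\alpha B)^*$: it relates $s_1\cdots s_k$ to $b_1\cdots b_k$ whenever $(s_i,b_i)\in[\![M]\!]$ for all $i$. -}

module Defs where

open import Algebra.Bundles using (Monoid)
open import Data.List.Base using (List; []; _∷_; [_]; _++_; foldr; map; replicate)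
open import Data.List.Membership.Propositional using (_∉_)
open import Data.List.Properties using (++-monoid)
open import Data.List.Relation.Binary.Disjoint.Propositional using (Disjoint)
open import Data.List.Relation.Binary.Permutation.Propositional using (_↭_; ↭-sym)
open import Data.List.Relation.Binary.Permutation.Propositional.Properties using (All-resp-↭)
open import Data.List.Relation.Binary.Pointwise using (Pointwise; []; _∷_)
import Data.List.Relation.Binary.Pointwise as Pointwise
open import Data.List.Relation.Unary.All as All using (All; []; _∷_)
open import Data.List.Relation.Unary.All.Properties using (++⁻ˡ; ++⁻ʳ)
open import Data.List.Relation.Unary.Unique.Propositional using (Unique)
open import Data.Nat.Base using (ℕ; _+_; _∸_)
open import Data.Product.Base using (∃-syntax; _×_; _,_; proj₁; uncurry)
open import Data.Sum.Base using (_⊎_)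
open import Data.Unit.Base using (⊤; tt)
open import Function.Bundles using (_⇔_)
open import Level using (0ℓ; suc)
open import Relation.Binary.Core using (REL)
open import Relation.Binary.PropositionalEquality using (_≡_; _≢_; refl)

------------------------------------------------------------------------
-- Syntax

infixr 7 _⊸_

data Ty : Set where
  nat comm var : Ty
  _⊸_          : Ty → Ty → Ty

data Base : Ty → Set where
  nat  : Base nat
  comm : Base comm
  var  : Base var

record Operations : Set₁ where
  field
    Op         : Set
    eval       : Op → ℕ → ℕ → ℕ
    plus       : Op
    minus      : Op
    eval-plus  : ∀ m n → eval plus m n ≡ m + n
    eval-minus : ∀ m n → eval minus m n ≡ m ∸ n

open Operations

Id : Set
Id = ℕ

-- Representatives of α-equivalence classes: the typing relation below needs no
-- α-rule, because weakening may introduce an identifier that the term also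
-- binds, so that renaming bound identifiers preserves typability.

infixl 7 _·_

data Term (ops : Operations) : Set where
  num    : ℕ → Term ops
  arith  : Op ops → Term ops → Term ops → Term ops
  skip   : Term ops
  seq    : Term ops → Term ops → Term ops
  assign : Term ops → Term ops → Term ops
  deref  : Term ops → Term ops
  while  : Term ops → Term ops → Term ops
  ifzero : Term ops → Term ops → Term ops → Term ops
  `_     : Id → Term ops
  ƛ      : Id → Ty → Term ops → Term ops
  _·_    : Term ops → Term ops → Term ops
  new    : Id → Term ops → Term ops
  random : Term ops
  mkvar  : Term ops → Term ops → Term ops

------------------------------------------------------------------------
-- Typing

-- Lists are extended at the head: Γ , x : A is written (x , A) ∷ Γ.

Ctx : Set
Ctx = List (Id × Ty)

dom : Ctx → List Id
dom = map proj₁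

private
  variable
    ops     : Operations
    Γ Δ     : Ctx
    A B     : Ty
    M N N₁ N₂ : Term ops
    x       : Id

infix 4 _⊢_∶_

-- Contexts have distinct identifiers. The side conditions of weakening,
-- application and random ensure this; the other rules inherit it from their
-- premises.

data _⊢_∶_ {ops : Operations} : Ctx → Term ops → Ty → Set where
  ⊢var    : (x , A) ∷ [] ⊢ ` x ∶ A
  ⊢ƛ      : (x , A) ∷ Γ ⊢ M ∶ B → Γ ⊢ ƛ x A M ∶ A ⊸ B
  ⊢app    : Disjoint (dom Γ) (dom Δ) →
            Γ ⊢ M ∶ A ⊸ B → Δ ⊢ N ∶ A → Γ ++ Δ ⊢ M · N ∶ B
  ⊢weak   : x ∉ dom Γ → Γ ⊢ M ∶ B → (x , A) ∷ Γ ⊢ M ∶ B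
  ⊢exch   : Γ ↭ Δ → Γ ⊢ M ∶ B → Δ ⊢ M ∶ B
  ⊢num    : ∀ n → [] ⊢ num n ∶ nat
  ⊢skip   : [] ⊢ skip ∶ comm
  ⊢arith  : ∀ o → Γ ⊢ M ∶ nat → Γ ⊢ N ∶ nat → Γ ⊢ arith o M N ∶ nat
  ⊢seq    : Base B → Γ ⊢ M ∶ comm → Γ ⊢ N ∶ B → Γ ⊢ seq M N ∶ B
  ⊢assign : Γ ⊢ M ∶ var → Γ ⊢ N ∶ nat → Γ ⊢ assign M N ∶ comm
  ⊢deref  : Γ ⊢ M ∶ var → Γ ⊢ deref M ∶ nat
  ⊢while  : Γ ⊢ M ∶ nat → Γ ⊢ N ∶ comm → Γ ⊢ while M N ∶ comm
  ⊢ifzero : Base B → Γ ⊢ M ∶ nat → Γ ⊢ N₁ ∶ B → Γ ⊢ N₂ ∶ B →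
            Γ ⊢ ifzero M N₁ N₂ ∶ B
  ⊢new    : B ≡ comm ⊎ B ≡ nat → (x , var) ∷ Γ ⊢ M ∶ B → Γ ⊢ new x M ∶ B
  ⊢random : Unique (dom Γ) → Γ ⊢ random ∶ nat
  ⊢mkvar  : Γ ⊢ M ∶ nat ⊸ comm → Γ ⊢ N ∶ nat → Γ ⊢ mkvar M N ∶ var

------------------------------------------------------------------------
-- Denotational semantics

data Action : Set where
  read write : ℕ → Action

α : Ty → Set
α nat     = ℕ
α comm    = ⊤
α var     = Action
α (A ⊸ B) = List (α A) × α B

Traces : Ctx → Set
Traces = All (λ (_ , A) → List (α A))

infixr 5 _∙_

ε : Traces Γ
ε = All.universal (λ _ → []) _

_∙_ : Traces Γ → Traces Γ → Traces Γ
s ∙ t = All.zipWith (uncurry _++_) (s , t)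

concat : List (Traces Γ) → Traces Γ
concat = foldr _∙_ ε

CellFrom : ℕ → List Action → Set
CellFrom v []            = ⊤
CellFrom v (read n ∷ s)  = n ≡ v × CellFrom v s
CellFrom v (write n ∷ s) = CellFrom n s

CellTrace : List Action → Set
CellTrace = CellFrom 0

⟦_⟧ : {M : Term ops} → Γ ⊢ M ∶ B → Traces Γ → α B → Set
⟦ ⊢var ⟧ (s ∷ []) a = s ≡ [ a ]
⟦ ⊢ƛ d ⟧ ss (s , b) = ⟦ d ⟧ (s ∷ ss) b
⟦ ⊢app {Γ = Γ} _ d e ⟧ ss b =
  ∃[ as ] ∃[ ts ] ⟦ d ⟧ (++⁻ˡ Γ ss) (as , b)
                × Pointwise ⟦ e ⟧ ts as
                × ++⁻ʳ Γ ss ≡ concat ts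
⟦ ⊢weak _ d ⟧ (s ∷ ss) b = s ≡ [] × ⟦ d ⟧ ss b
⟦ ⊢exch p d ⟧ ss b = ⟦ d ⟧ (All-resp-↭ (↭-sym p) ss) b
⟦ ⊢num n ⟧ _ m = m ≡ n
⟦ ⊢skip ⟧ _ _ = ⊤
⟦_⟧ {ops = ops} (⊢arith o d e) ss n =
  ∃[ s ] ∃[ s′ ] ∃[ m₁ ] ∃[ m₂ ]
    ss ≡ s ∙ s′ × ⟦ d ⟧ s m₁ × ⟦ e ⟧ s′ m₂ × n ≡ eval ops o m₁ m₂
⟦ ⊢seq _ d e ⟧ ss b =
  ∃[ s ] ∃[ s′ ] ss ≡ s ∙ s′ × ⟦ d ⟧ s tt × ⟦ e ⟧ s′ b
⟦ ⊢assign d e ⟧ ss _ =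
  ∃[ s ] ∃[ s′ ] ∃[ n ] ss ≡ s ∙ s′ × ⟦ e ⟧ s n × ⟦ d ⟧ s′ (write n)
⟦ ⊢deref d ⟧ ss n = ⟦ d ⟧ ss (read n)
-- us lists the iterations: its i-th entry is sⁱ tⁱ.
⟦ ⊢while d e ⟧ ss _ =
  ∃[ us ] ∃[ s ] ∃[ m ]
    ss ≡ concat us ∙ s
    × All (λ u → ∃[ sᵢ ] ∃[ tᵢ ] u ≡ sᵢ ∙ tᵢ × ⟦ d ⟧ sᵢ 0 × ⟦ e ⟧ tᵢ tt) us
    × m ≢ 0 × ⟦ d ⟧ s m
⟦ ⊢ifzero _ d e₁ e₂ ⟧ ss b =
  (∃[ s ] ∃[ t ] ss ≡ s ∙ t × ⟦ d ⟧ s 0 × ⟦ e₁ ⟧ t b) ⊎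
  (∃[ s ] ∃[ t ] ∃[ m ] ss ≡ s ∙ t × m ≢ 0 × ⟦ d ⟧ s m × ⟦ e₂ ⟧ t b)
⟦ ⊢new _ d ⟧ ss b = ∃[ s ] ⟦ d ⟧ (s ∷ ss) b × CellTrace s
⟦ ⊢random _ ⟧ ss _ = ss ≡ ε
-- In the first clause, ∃ k … is what (ss , *) ∈ ⟦ M n ⟧ unfolds to.
⟦ ⊢mkvar d e ⟧ ss (write n) = ∃[ k ] ⟦ d ⟧ ss (replicate k n , tt)
⟦ ⊢mkvar d e ⟧ ss (read n) = ⟦ e ⟧ ss n

------------------------------------------------------------------------
-- MonRel

record MonRel (P Q : Monoid 0ℓ 0ℓ) : Set (suc 0ℓ) where
  private
    module P = Monoid P
    module Q = Monoid Q
  field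
    rel   : REL P.Carrier Q.Carrier 0ℓ
    resp  : ∀ {a a′ b b′} → a P.≈ a′ → b Q.≈ b′ → rel a b → rel a′ b′
    unit  : rel P.ε Q.ε
    mult  : ∀ {a₁ a₂ b₁ b₂} → rel a₁ b₁ → rel a₂ b₂ →
            rel (a₁ P.∙ a₂) (b₁ Q.∙ b₂)
    unit⁻ : ∀ {a} → rel a Q.ε → a P.≈ P.ε
    mult⁻ : ∀ {a b₁ b₂} → rel a (b₁ Q.∙ b₂) →
            ∃[ a₁ ] ∃[ a₂ ] a P.≈ a₁ P.∙ a₂ × rel a₁ b₁ × rel a₂ b₂

open MonRel

infix 4 _≈_

_≈_ : {P Q : Monoid 0ℓ 0ℓ} → MonRel P Q → MonRel P Q → Set
R ≈ S = ∀ a b → rel R a b ⇔ rel S a b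

idᴹ : (P : Monoid 0ℓ 0ℓ) → MonRel P P
idᴹ P = record
  { rel   = P._≈_
  ; resp  = λ a≈a′ b≈b′ a≈b → P.trans (P.sym a≈a′) (P.trans a≈b b≈b′)
  ; unit  = P.refl
  ; mult  = P.∙-cong
  ; unit⁻ = λ a≈ε → a≈ε
  ; mult⁻ = λ a≈bb → _ , _ , a≈bb , P.refl , P.refl
  }
  where module P = Monoid P

-- Composition in diagrammatic order.

infixl 6 _⨾_

_⨾_ : {P Q R : Monoid 0ℓ 0ℓ} → MonRel P Q → MonRel Q R → MonRel P R
_⨾_ {P} {Q} {R} F G = record
  { rel   = λ a c → ∃[ b ] rel F a b × rel G b c
  ; resp  = λ a≈a′ c≈c′ (b , f , g) →
              b , resp F a≈a′ Q.refl f , resp G Q.refl c≈c′ g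
  ; unit  = _ , unit F , unit G
  ; mult  = λ (_ , f₁ , g₁) (_ , f₂ , g₂) → _ , mult F f₁ f₂ , mult G g₁ g₂
  ; unit⁻ = λ (_ , f , g) → unit⁻ F (resp F P.refl (unit⁻ G g) f)
  ; mult⁻ = λ (_ , f , g) →
      let _ , _ , b≈ , g₁ , g₂ = mult⁻ G g
          _ , _ , a≈ , f₁ , f₂ = mult⁻ F (resp F P.refl b≈ f)
      in _ , _ , a≈ , (_ , f₁ , g₁) , (_ , f₂ , g₂)
  }
  where
  module P = Monoid P
  module Q = Monoid Q

Free : Set → Monoid 0ℓ 0ℓ
Free X = ++-monoid X

-- The morphism into a free monoid determined by its restriction R to
-- generators: it relates s₁ ⋯ s_k to b₁ ⋯ b_k whenever each (sᵢ , bᵢ) ∈ R.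

extend : (P : Monoid 0ℓ 0ℓ) {X : Set} → REL (Monoid.Carrier P) X 0ℓ → MonRel P (Free X)
extend P {X} R = record
  { rel   = Ext
  ; resp  = λ { a≈a′ refl (ss , rs , a≈) → ss , rs , P.trans (P.sym a≈a′) a≈ }
  ; unit  = [] , [] , P.refl
  ; mult  = λ (ss , rs , a≈) (ss′ , rs′ , a≈′) →
      ss ++ ss′ , Pointwise.++⁺ rs rs′ ,
      P.trans (P.∙-cong a≈ a≈′) (P.sym (prod-++ ss ss′))
  ; unit⁻ = λ { (_ , [] , a≈) → a≈ }
  ; mult⁻ = λ {_} {bs} (ss , rs , a≈) →
      let ss₁ , ss₂ , rs₁ , rs₂ , eq = split bs rs
      in prod ss₁ , prod ss₂ , P.trans a≈ eq ,
         (ss₁ , rs₁ , P.refl) , (ss₂ , rs₂ , P.refl)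
  }
  where
  module P = Monoid P

  prod : List P.Carrier → P.Carrier
  prod = foldr P._∙_ P.ε

  Ext : P.Carrier → List X → Set
  Ext a bs = ∃[ ss ] Pointwise R ss bs × a P.≈ prod ss

  prod-++ : ∀ ss ss′ → prod (ss ++ ss′) P.≈ prod ss P.∙ prod ss′
  prod-++ []       ss′ = P.sym (P.identityˡ _)
  prod-++ (s ∷ ss) ss′ =
    P.trans (P.∙-congˡ (prod-++ ss ss′)) (P.sym (P.assoc _ _ _))

  split : ∀ bs {bs′ ss} → Pointwise R ss (bs ++ bs′) →
          ∃[ ss₁ ] ∃[ ss₂ ] Pointwise R ss₁ bs × Pointwise R ss₂ bs′ ×
            prod ss P.≈ prod ss₁ P.∙ prod ss₂
  split []       rs       = _ , _ , [] , rs , P.sym (P.identityˡ _)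
  split (b ∷ bs) (r ∷ rs) =
    let _ , _ , rs₁ , rs₂ , eq = split bs rs
    in _ , _ , r ∷ rs₁ , rs₂ ,
       P.trans (P.∙-congˡ eq) (P.sym (P.assoc _ _ _))

⟦_⟧ᴹ : {M : Term ops} → (x , A) ∷ [] ⊢ M ∶ B → MonRel (Free (α A)) (Free (α B))
⟦ d ⟧ᴹ = extend _ (λ s b → ⟦ d ⟧ (s ∷ []) b)

{-# OPTIONS --safe #-}
module Submission where

-- Retracts compose, and they are functorial in ⊸, so by induction on types it is
-- enough to treat the base types and nat ⊸ nat. A trace (n₁ ⋯ n_k , n) of a
-- function is coded injectively as a number by repeatedly storing
-- (2c + 1) 2ⁿ over c. For `in`, the function is applied to an argument that
-- returns a random number at each call and records it in a local cell. No
-- decoding is needed for `out`: it calls its argument a random number of times,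
-- recording the answers, guesses a result, and diverges unless the code recorded
-- in this way equals the given number. A variable is treated in the same way,
-- its actions being coded by (2c + 1) 2ⁿ with c = 0 for read(n) and c = 1 for
-- write(n).

open import Data.Empty using (⊥; ⊥-elim)
open import Data.List.Base using (List; []; _∷_; [_]; _++_; foldl; foldr; reverse)
open import Data.List.Membership.Propositional using (_∉_)
open import Data.List.Properties
  using (++-assoc; ++-identityʳ; reverse-foldr; reverse-injective)
open import Data.List.Relation.Binary.Permutation.Propositional using (refl; swap)
open import Data.List.Relation.Binary.Pointwise
  using (Pointwise; []; _∷_; symmetric; transitive; Pointwise-≡⇒≡)
open import Data.List.Relation.Unary.All using (All; []; _∷_)
open import Data.List.Relation.Unary.All.Properties using (All¬⇒¬Any)
open import Data.List.Relation.Unary.AllPairs using ([]; _∷_)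
open import Data.List.Relation.Unary.Any using (here; there)
open import Data.List.Relation.Unary.Unique.Propositional using (Unique)
open import Data.Nat.Base using (ℕ; zero; suc; _+_; _∸_)
open import Data.Nat.Properties
open import Data.List.Relation.Unary.Unique.DecPropositional _≟_ using (unique?)
open import Data.Product.Base using (Σ-syntax; ∃-syntax; _×_; _,_; proj₁; proj₂)
open import Data.Sum.Base using (inj₁; inj₂)
open import Data.Unit.Base using (⊤; tt)
open import Function.Base using (flip; _∘_)
open import Function.Bundles using (_⇔_; mk⇔; Equivalence)
open import Relation.Nullary.Decidable using (toWitness)
open import Relation.Binary.PropositionalEquality
  using (_≡_; _≢_; refl; sym; trans; cong; cong₂; subst)
open import Defs

open Equivalence using (to; from)
open Operations using (plus; minus; eval-plus; eval-minus)

private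
  variable
    ops : Operations
    Γ : Ctx
    A A′ B B′ : Ty
    M N N₁ N₂ : Term ops
    x y : Id

-- Runs

-- A denotation is read as the big-step relation between the states before and
-- after the evaluation. An identifier of kind cell behaves as a local variable
-- with a current value; the state of one of kind tape is the part of its trace
-- that is still to be consumed.
data Kind : Ty → Set where
  cell : Kind var
  tape : Kind A

St : Kind A → Set
St cell         = ℕ
St {A = A} tape = List (α A)

Moves : (k : Kind A) → St k → List (α A) → St k → Set
Moves cell m []            n = m ≡ n
Moves cell m (read j ∷ t)  n = j ≡ m × Moves cell m t n
Moves cell m (write j ∷ t) n = Moves cell j t n
Moves tape s t             u = s ≡ t ++ u

infixr 5 _∷_

data Layout : Ctx → Set where
  []  : Layout []
  _∷_ : Kind A → Layout Γ → Layout ((x , A) ∷ Γ)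

State : Layout Γ → Set
State []       = ⊤
State (k ∷ ks) = St k × State ks

Moves* : (ks : Layout Γ) → State ks → Traces Γ → State ks → Set
Moves* []       _       []       _       = ⊤
Moves* (k ∷ ks) (s , σ) (t ∷ ts) (u , τ) = Moves k s t u × Moves* ks σ ts τ

-- Hiding the trace lets evaluations be chained through a common intermediate state, where the
-- denotation factors a trace.
record Run {M : Term ops} (ks : Layout Γ) (d : Γ ⊢ M ∶ B)
           (σ : State ks) (b : α B) (τ : State ks) : Set where
  constructor run
  field
    {trace} : Traces Γ
    denotes : ⟦ d ⟧ trace b
    moves   : Moves* ks σ trace τ

private
  variable
    ks : Layout Γ

-- Moves along concatenated and empty traces.

moves-++⁻ : (k : Kind A) {s u : St k} (t t′ : List (α A)) → Moves k s (t ++ t′) u →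
            ∃[ r ] Moves k s t r × Moves k r t′ u
moves-++⁻ cell []            t′ m       = _ , refl , m
moves-++⁻ cell (read j ∷ t)  t′ (e , m) =
  let _ , m₁ , m₂ = moves-++⁻ cell t t′ m in _ , (e , m₁) , m₂
moves-++⁻ cell (write j ∷ t) t′ m       = moves-++⁻ cell t t′ m
moves-++⁻ tape {u = u} t     t′ m       = t′ ++ u , trans m (++-assoc t t′ u) , refl

moves-++⁺ : (k : Kind A) {s r u : St k} (t t′ : List (α A)) →
            Moves k s t r → Moves k r t′ u → Moves k s (t ++ t′) u
moves-++⁺ cell []            t′ refl    m′ = m′
moves-++⁺ cell (read j ∷ t)  t′ (e , m) m′ = e , moves-++⁺ cell t t′ m m′
moves-++⁺ cell (write j ∷ t) t′ m       m′ = moves-++⁺ cell t t′ m m′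
moves-++⁺ tape {u = u} t     t′ refl  refl = sym (++-assoc t t′ u)

moves-∙⁻ : (ks : Layout Γ) {σ τ : State ks} (s t : Traces Γ) → Moves* ks σ (s ∙ t) τ →
           ∃[ ρ ] Moves* ks σ s ρ × Moves* ks ρ t τ
moves-∙⁻ []       []      []      _        = _
moves-∙⁻ (k ∷ ks) (s ∷ ss) (t ∷ ts) (m , ms) =
  let _ , m₁ , m₂ = moves-++⁻ k s t m
      _ , ms₁ , ms₂ = moves-∙⁻ ks ss ts ms
  in _ , (m₁ , ms₁) , (m₂ , ms₂)

moves-∙⁺ : (ks : Layout Γ) {σ ρ τ : State ks} (s t : Traces Γ) →
           Moves* ks σ s ρ → Moves* ks ρ t τ → Moves* ks σ (s ∙ t) τ
moves-∙⁺ []       []       []       _        _          = _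
moves-∙⁺ (k ∷ ks) (s ∷ ss) (t ∷ ts) (m , ms) (m′ , ms′) =
  moves-++⁺ k s t m m′ , moves-∙⁺ ks ss ts ms ms′

moves-[] : (k : Kind A) {s u : St k} → Moves k s [] u ⇔ s ≡ u
moves-[] cell = mk⇔ (λ m → m) (λ m → m)
moves-[] tape = mk⇔ (λ m → m) (λ m → m)

moves-ε⁻ : (ks : Layout Γ) {σ τ : State ks} → Moves* ks σ ε τ → σ ≡ τ
moves-ε⁻ []       _        = refl
moves-ε⁻ (k ∷ ks) (m , ms) = cong₂ _,_ (to (moves-[] k) m) (moves-ε⁻ ks ms)

moves-ε⁺ : (ks : Layout Γ) {σ : State ks} → Moves* ks σ ε σ
moves-ε⁺ []       = _
moves-ε⁺ (k ∷ ks) = from (moves-[] k) refl , moves-ε⁺ ks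

-- Evaluation rules for the term formers.

run-weak : {k : Kind A} {ks : Layout Γ} {x∉Γ : x ∉ dom Γ} {d : Γ ⊢ M ∶ B}
           {s u : St k} {σ τ : State ks} {b : α B} →
           Run (k ∷ ks) (⊢weak {A = A} x∉Γ d) (s , σ) b (u , τ) ⇔ (s ≡ u × Run ks d σ b τ)
run-weak {k = k} = mk⇔
  (λ { (run {_ ∷ _} (refl , ds) (m , ms)) → to (moves-[] k) m , run ds ms })
  (λ { (refl , run ds ms) → run {trace = _ ∷ _} (refl , ds) (from (moves-[] k) refl , ms) })

run-swap : {k : Kind A} {l : Kind B} {d : (x , A) ∷ (y , B) ∷ Γ ⊢ M ∶ A′}
           {s s′ : St k} {u u′ : St l} {σ τ : State ks} {b : α A′} →
           Run (l ∷ k ∷ ks) (⊢exch (swap _ _ refl) d) (u , s , σ) b (u′ , s′ , τ) ⇔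
           Run (k ∷ l ∷ ks) d (s , u , σ) b (s′ , u′ , τ)
run-swap = mk⇔
  (λ { (run {_ ∷ _ ∷ _} ds (m , m′ , ms)) → run {trace = _ ∷ _ ∷ _} ds (m′ , m , ms) })
  (λ { (run {_ ∷ _ ∷ _} ds (m , m′ , ms)) → run {trace = _ ∷ _ ∷ _} ds (m′ , m , ms) })

-- A factorisation `s ∙ t` of the trace corresponds to the state `ρ` reached after `s`. The other
-- sequential rules work in the same way.
run-arith : ∀ {o} {d : Γ ⊢ M ∶ nat} {e : Γ ⊢ N ∶ nat} {σ τ : State ks} {n} →
            Run {ops} ks (⊢arith o d e) σ n τ ⇔
            (∃[ m₁ ] ∃[ ρ ] ∃[ m₂ ] Run ks d σ m₁ ρ × Run ks e ρ m₂ τ ×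
             n ≡ Operations.eval ops o m₁ m₂)
run-arith {ks = ks} = mk⇔
  (λ { (run (s , t , _ , _ , refl , ds , es , eq) ms) →
       let _ , m₁ , m₂ = moves-∙⁻ ks s t ms in _ , _ , _ , run ds m₁ , run es m₂ , eq })
  (λ { (_ , _ , _ , run {s} ds m₁ , run {t} es m₂ , eq) →
       run (s , t , _ , _ , refl , ds , es , eq) (moves-∙⁺ ks s t m₁ m₂) })

run-seq : ∀ {bt : Base B} {d : Γ ⊢ M ∶ comm} {e : Γ ⊢ N ∶ B} {σ τ : State ks} {b} →
          Run ks (⊢seq bt d e) σ b τ ⇔ (∃[ ρ ] Run ks d σ tt ρ × Run ks e ρ b τ)
run-seq {ks = ks} = mk⇔
  (λ { (run (s , t , refl , ds , es) ms) →
       let _ , m₁ , m₂ = moves-∙⁻ ks s t ms in _ , run ds m₁ , run es m₂ })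
  (λ { (_ , run {s} ds m₁ , run {t} es m₂) →
       run (s , t , refl , ds , es) (moves-∙⁺ ks s t m₁ m₂) })

run-assign : ∀ {d : Γ ⊢ M ∶ var} {e : Γ ⊢ N ∶ nat} {σ τ : State ks} →
             Run ks (⊢assign d e) σ tt τ ⇔
             (∃[ n ] ∃[ ρ ] Run ks e σ n ρ × Run ks d ρ (write n) τ)
run-assign {ks = ks} = mk⇔
  (λ { (run (s , t , _ , refl , es , ds) ms) →
       let _ , m₁ , m₂ = moves-∙⁻ ks s t ms in _ , _ , run es m₁ , run ds m₂ })
  (λ { (_ , _ , run {s} es m₁ , run {t} ds m₂) →
       run (s , t , _ , refl , es , ds) (moves-∙⁺ ks s t m₁ m₂) })

run-deref : ∀ {d : Γ ⊢ M ∶ var} {σ τ : State ks} {n} →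
            Run ks (⊢deref d) σ n τ ⇔ Run ks d σ (read n) τ
run-deref = mk⇔ (λ { (run ds ms) → run ds ms }) (λ { (run ds ms) → run ds ms })

data Branch {M N₁ N₂ : Term ops} (ks : Layout Γ)
            (d : Γ ⊢ M ∶ nat) (e₁ : Γ ⊢ N₁ ∶ B) (e₂ : Γ ⊢ N₂ ∶ B) :
            State ks → α B → State ks → Set where
  isZero  : ∀ {σ b ρ τ} → Run ks d σ 0 ρ → Run ks e₁ ρ b τ → Branch ks d e₁ e₂ σ b τ
  nonZero : ∀ {σ b ρ τ m} → m ≢ 0 → Run ks d σ m ρ → Run ks e₂ ρ b τ →
            Branch ks d e₁ e₂ σ b τ

run-ifzero : ∀ {bt : Base B} {d : Γ ⊢ M ∶ nat} {e₁ : Γ ⊢ N₁ ∶ B} {e₂ : Γ ⊢ N₂ ∶ B}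
             {σ τ : State ks} {b} →
             Run ks (⊢ifzero bt d e₁ e₂) σ b τ ⇔ Branch ks d e₁ e₂ σ b τ
run-ifzero {ks = ks} = mk⇔
  (λ { (run (inj₁ (s , t , refl , ds , es)) ms) →
         let _ , m₁ , m₂ = moves-∙⁻ ks s t ms in isZero (run ds m₁) (run es m₂)
     ; (run (inj₂ (s , t , _ , refl , m≢0 , ds , es)) ms) →
         let _ , m₁ , m₂ = moves-∙⁻ ks s t ms in nonZero m≢0 (run ds m₁) (run es m₂) })
  (λ { (isZero (run {s} ds m₁) (run {t} es m₂)) →
         run (inj₁ (s , t , refl , ds , es)) (moves-∙⁺ ks s t m₁ m₂)
     ; (nonZero m≢0 (run {s} ds m₁) (run {t} es m₂)) →
         run (inj₂ (s , t , _ , refl , m≢0 , ds , es)) (moves-∙⁺ ks s t m₁ m₂) })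

-- The list of iterations in the denotation becomes an inductive relation between states, on which
-- properties of loops are proved by recursion.
data Loop {M N : Term ops} (ks : Layout Γ) (d : Γ ⊢ M ∶ nat) (e : Γ ⊢ N ∶ comm) :
          State ks → State ks → Set where
  stop  : ∀ {σ τ m} → m ≢ 0 → Run ks d σ m τ → Loop ks d e σ τ
  again : ∀ {σ ρ ρ′ τ} → Run ks d σ 0 ρ → Run ks e ρ tt ρ′ → Loop ks d e ρ′ τ →
          Loop ks d e σ τ

iterations⁻ : ∀ {d : Γ ⊢ M ∶ nat} {e : Γ ⊢ N ∶ comm} {σ ρ τ : State ks} {m us} →
              All (λ u → ∃[ s ] ∃[ t ] u ≡ s ∙ t × ⟦ d ⟧ s 0 × ⟦ e ⟧ t tt) us →
              Moves* ks σ (concat us) ρ → m ≢ 0 → Run ks d ρ m τ → Loop ks d e σ τ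
iterations⁻ {ks = ks} [] ms m≢0 r with refl ← moves-ε⁻ ks ms = stop m≢0 r
iterations⁻ {ks = ks} ((s , t , refl , ds , es) ∷ its) ms m≢0 r =
  let _ , m₁ , m₂ = moves-∙⁻ ks (s ∙ t) _ ms
      _ , m₃ , m₄ = moves-∙⁻ ks s t m₁
  in again (run ds m₃) (run es m₄) (iterations⁻ its m₂ m≢0 r)

run-while⁻ : ∀ {d : Γ ⊢ M ∶ nat} {e : Γ ⊢ N ∶ comm} {σ τ : State ks} →
             Run ks (⊢while d e) σ tt τ → Loop ks d e σ τ
run-while⁻ {ks = ks} (run (us , s , _ , refl , its , m≢0 , ds) ms) =
  let _ , m₁ , m₂ = moves-∙⁻ ks (concat us) s ms in iterations⁻ its m₁ m≢0 (run ds m₂)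

run-while⁺ : ∀ {d : Γ ⊢ M ∶ nat} {e : Γ ⊢ N ∶ comm} {σ τ : State ks} →
             Loop ks d e σ τ → Run ks (⊢while d e) σ tt τ
run-while⁺ {ks = ks} (stop m≢0 (run {s} ds ms)) =
  run ([] , s , _ , refl , [] , m≢0 , ds) (moves-∙⁺ ks ε s (moves-ε⁺ ks) ms)
run-while⁺ {ks = ks} (again (run {s₁} ds m₅) (run {t₁} es m₆) l)
  with run (us , s , m , refl , its , r) ms ← run-while⁺ l =
  let _ , m₄ , m₂ = moves-∙⁻ ks (concat us) s ms
  in run (_ ∷ us , s , m , refl , (s₁ , t₁ , refl , ds , es) ∷ its , r)
       (moves-∙⁺ ks _ s (moves-∙⁺ ks (s₁ ∙ t₁) _ (moves-∙⁺ ks s₁ t₁ m₅ m₆) m₄) m₂)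

-- `CellFrom` constrains the reads without naming a final value; following the writes recovers it.
cellFrom⁻ : ∀ {m} t → CellFrom m t → ∃[ n ] Moves cell m t n
cellFrom⁻ []            _       = _ , refl
cellFrom⁻ (read _ ∷ t)  (e , c) = let _ , m = cellFrom⁻ t c in _ , e , m
cellFrom⁻ (write _ ∷ t) c       = cellFrom⁻ t c

cellFrom⁺ : ∀ {m n} t → Moves cell m t n → CellFrom m t
cellFrom⁺ []            _       = _
cellFrom⁺ (read _ ∷ t)  (e , m) = e , cellFrom⁺ t m
cellFrom⁺ (write _ ∷ t) m       = cellFrom⁺ t m

run-new : ∀ {p} {d : (x , var) ∷ Γ ⊢ M ∶ B} {σ τ : State ks} {b} →
          Run ks (⊢new p d) σ b τ ⇔ (∃[ n ] Run (cell ∷ ks) d (0 , σ) b (n , τ))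
run-new = mk⇔
  (λ { (run (s , ds , c) ms) →
       let _ , m = cellFrom⁻ s c in _ , run {trace = _ ∷ _} ds (m , ms) })
  (λ { (_ , run {s ∷ _} ds (m , ms)) → run (s , ds , cellFrom⁺ s m) ms })

run-random : ∀ {u} {σ τ : State ks} {n} → Run {ops} ks (⊢random {Γ = Γ} u) σ n τ ⇔ σ ≡ τ
run-random {ks = ks} = mk⇔
  (λ { (run refl ms) → moves-ε⁻ ks ms })
  (λ { refl → run refl (moves-ε⁺ ks) })

-- Variables and constants in context

∉-head : {xs : List Id} → Unique (x ∷ xs) → x ∉ xs
∉-head (x≢xs ∷ _) = All¬⇒¬Any x≢xs

tail-unique : {xs : List Id} → Unique (x ∷ xs) → Unique xs
tail-unique (_ ∷ u) = u

-- Weakening acts at the head of the context, so each further identifier is added in front and then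
-- exchanged past `x`.
⊢head : Unique (x ∷ dom Γ) → _⊢_∶_ {ops} ((x , A) ∷ Γ) (` x) A
⊢head {Γ = []}    _ = ⊢var
⊢head {Γ = _ ∷ _} ((x≢y ∷ x≢Γ) ∷ (y≢Γ ∷ u)) =
  ⊢exch (swap _ _ refl) (⊢weak (All¬⇒¬Any ((x≢y ∘ sym) ∷ y≢Γ)) (⊢head (x≢Γ ∷ u)))

run-head : ∀ {k : Kind A} {ks : Layout Γ} {u : Unique (x ∷ dom Γ)} {s s′ σ τ a} →
           Run {ops = ops} (k ∷ ks) (⊢head u) (s , σ) a (s′ , τ) ⇔ (Moves k s [ a ] s′ × σ ≡ τ)
run-head {ks = []} = mk⇔
  (λ { (run {_ ∷ []} refl (m , _)) → m , refl })
  (λ { (m , _) → run {trace = _ ∷ []} refl (m , _) })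
run-head {ks = _ ∷ ks} {u = (_ ∷ _) ∷ (_ ∷ _)} = mk⇔
  (λ r → let e , r′ = to run-weak (to run-swap r)
             m , e′ = to (run-head {ks = ks}) r′
         in m , cong₂ _,_ e e′)
  (λ { (m , refl) → from run-swap (from run-weak (refl , from (run-head {ks = ks}) (m , refl))) })

⊢closed : Unique (dom Γ) → [] ⊢ M ∶ B → Γ ⊢ M ∶ B
⊢closed {Γ = []}    _             d = d
⊢closed {Γ = _ ∷ _} u@(_ ∷ u′) d = ⊢weak (∉-head u) (⊢closed u′ d)

run-closed : ∀ {ks : Layout Γ} {u : Unique (dom Γ)} {d : [] ⊢ M ∶ B} {σ τ b} →
             Run ks (⊢closed u d) σ b τ ⇔ (⟦ d ⟧ [] b × σ ≡ τ)
run-closed {ks = []} = mk⇔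
  (λ { (run {[]} ds _) → ds , refl })
  (λ { (ds , _) → run ds _ })
run-closed {ks = _ ∷ ks} {_ ∷ _} = mk⇔
  (λ r → let e , r′ = to run-weak r
             ds , e′ = to (run-closed {ks = ks}) r′
         in ds , cong₂ _,_ e e′)
  (λ { (ds , refl) → from run-weak (refl , from (run-closed {ks = ks}) (ds , refl)) })

-- Deterministic programs

-- `pure⁺` takes any value with a proof that it equals `v σ`, so that an arithmetic identity can be
-- applied at the point of use.
record Pure {M : Term ops} (ks : Layout Γ) (d : Γ ⊢ M ∶ B) (v : State ks → α B) : Set where
  field
    pure⁻ : ∀ {σ b τ} → Run ks d σ b τ → b ≡ v σ × σ ≡ τ
    pure⁺ : ∀ {σ b} → b ≡ v σ → Run ks d σ b σ

record Effect {M : Term ops} (ks : Layout Γ) (d : Γ ⊢ M ∶ comm) (f : State ks → State ks) :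
              Set where
  field
    effect⁻ : ∀ {σ τ} → Run ks d σ tt τ → τ ≡ f σ
    effect⁺ : ∀ σ → Run ks d σ tt (f σ)

-- A variable seen as a lens on states.
record Ref {M : Term ops} (ks : Layout Γ) (d : Γ ⊢ M ∶ var)
           (get : State ks → ℕ) (set : ℕ → State ks → State ks) : Set where
  field
    read⁻  : ∀ {σ n τ} → Run ks d σ (read n) τ → n ≡ get σ × σ ≡ τ
    read⁺  : ∀ σ → Run ks d σ (read (get σ)) σ
    write⁻ : ∀ {σ n τ} → Run ks d σ (write n) τ → τ ≡ set n σ
    write⁺ : ∀ n σ → Run ks d σ (write n) (set n σ)

open Pure
open Effect
open Ref

ref-head : ∀ {ks : Layout Γ} {u : Unique (x ∷ dom Γ)} →
           Ref {ops = ops} (cell ∷ ks) (⊢head u) proj₁ (λ n (_ , σ) → n , σ)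
ref-head {ks = ks} = record
  { read⁻  = λ r → let (e , e′) , e″ = to (run-head {ks = ks}) r in e , cong₂ _,_ e′ e″
  ; read⁺  = λ _ → from (run-head {ks = ks}) ((refl , refl) , refl)
  ; write⁻ = λ r → let e , e′ = to (run-head {ks = ks}) r in sym (cong₂ _,_ e e′)
  ; write⁺ = λ _ _ → from (run-head {ks = ks}) (refl , refl)
  }

ref-weak : ∀ {k : Kind A} {x∉Γ : x ∉ dom Γ} {d : Γ ⊢ M ∶ var} {get set} → Ref ks d get set →
           Ref (k ∷ ks) (⊢weak x∉Γ d) (λ (_ , σ) → get σ) (λ n (s , σ) → s , set n σ)
ref-weak rf = record
  { read⁻  = λ r → let e , r′ = to run-weak r
                       e′ , e″ = read⁻ rf r′
                   in e′ , cong₂ _,_ e e″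
  ; read⁺  = λ (_ , σ) → from run-weak (refl , read⁺ rf σ)
  ; write⁻ = λ r → let e , r′ = to run-weak r in cong₂ _,_ (sym e) (write⁻ rf r′)
  ; write⁺ = λ n (_ , σ) → from run-weak (refl , write⁺ rf n σ)
  }

pure-num : ∀ {u : Unique (dom Γ)} {n} →
           Pure {ops = ops} ks (⊢closed u (⊢num n)) (λ _ → n)
pure-num {ks = ks} = record
  { pure⁻ = to (run-closed {ks = ks})
  ; pure⁺ = λ e → from (run-closed {ks = ks}) (e , refl)
  }

pure-deref : ∀ {d : Γ ⊢ M ∶ var} {get set} → Ref ks d get set → Pure ks (⊢deref d) get
pure-deref rf = record
  { pure⁻ = λ r → read⁻ rf (to run-deref r)
  ; pure⁺ = λ { refl → from run-deref (read⁺ rf _) }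
  }

add sub : Term ops → Term ops → Term ops
add {ops} = arith (plus ops)
sub {ops} = arith (minus ops)

⊢add : Γ ⊢ M ∶ nat → Γ ⊢ N ∶ nat → Γ ⊢ add M N ∶ nat
⊢add = ⊢arith _

⊢sub : Γ ⊢ M ∶ nat → Γ ⊢ N ∶ nat → Γ ⊢ sub M N ∶ nat
⊢sub = ⊢arith _

pure-add : ∀ {M N : Term ops} {d : Γ ⊢ M ∶ nat} {e : Γ ⊢ N ∶ nat} {v w} →
           Pure ks d v → Pure ks e w → Pure ks (⊢add d e) (λ σ → v σ + w σ)
pure-add {ops = ops} p q .pure⁻ r
  with _ , _ , _ , r₁ , r₂ , eq ← to run-arith r
  with refl , refl ← pure⁻ p r₁ | refl , refl ← pure⁻ q r₂ = trans eq (eval-plus ops _ _) , refl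
pure-add {ops = ops} p q .pure⁺ refl =
  from run-arith (_ , _ , _ , pure⁺ p refl , pure⁺ q refl , sym (eval-plus ops _ _))

pure-sub : ∀ {M N : Term ops} {d : Γ ⊢ M ∶ nat} {e : Γ ⊢ N ∶ nat} {v w} →
           Pure ks d v → Pure ks e w → Pure ks (⊢sub d e) (λ σ → v σ ∸ w σ)
pure-sub {ops = ops} p q .pure⁻ r
  with _ , _ , _ , r₁ , r₂ , eq ← to run-arith r
  with refl , refl ← pure⁻ p r₁ | refl , refl ← pure⁻ q r₂ = trans eq (eval-minus ops _ _) , refl
pure-sub {ops = ops} p q .pure⁺ refl =
  from run-arith (_ , _ , _ , pure⁺ p refl , pure⁺ q refl , sym (eval-minus ops _ _))

effect-assign : ∀ {d : Γ ⊢ M ∶ var} {e : Γ ⊢ N ∶ nat} {get set v} →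
                Ref ks d get set → Pure ks e v →
                Effect ks (⊢assign d e) (λ σ → set (v σ) σ)
effect-assign rf p .effect⁻ r
  with _ , _ , r₁ , r₂ ← to run-assign r
  with refl , refl ← pure⁻ p r₁ = write⁻ rf r₂
effect-assign rf p .effect⁺ σ = from run-assign (_ , _ , pure⁺ p refl , write⁺ rf _ σ)

effect-seq : ∀ {bt} {d : Γ ⊢ M ∶ comm} {e : Γ ⊢ N ∶ comm} {f g} →
             Effect ks d f → Effect ks e g → Effect ks (⊢seq bt d e) (g ∘ f)
effect-seq p q .effect⁻ r
  with _ , r₁ , r₂ ← to run-seq r
  with refl ← effect⁻ p r₁ = effect⁻ q r₂
effect-seq p q .effect⁺ σ = from run-seq (_ , effect⁺ p σ , effect⁺ q _)

-- Storing codes of sequences in a cell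

-- This is m 2ⁿ in accumulator form, with one unfolding per iteration of the loop `doublingᵗ`.
double : ℕ → ℕ → ℕ
double zero    m = m
double (suc n) m = double n (m + m)

-- code m n = (2m + 1) 2ⁿ
code : ℕ → ℕ → ℕ
code m n = double n (1 + (m + m))

-- Identifier 0 is the cell that holds a code, 1 and 2 are auxiliary cells, and 3
-- and 4 are the arguments of the closed terms.
doublingᵗ : Term ops
doublingᵗ = while (sub (num 1) (deref (` 1)))
  (seq (assign (` 1) (sub (deref (` 1)) (num 1))) (assign (` 0) (add (deref (` 0)) (deref (` 0)))))

-- `N` is evaluated before cell 0 is consulted, because it may itself change that cell: the answers
-- given to a function are already coded when its result is pushed.
pushᵗ : Term ops → Term ops
pushᵗ N = new 1 (seq (assign (` 1) N)
  (seq (assign (` 0) (add (num 1) (add (deref (` 0)) (deref (` 0))))) doublingᵗ))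

-- The two truncated differences add up to 0 only for equal numbers. Otherwise the loop with guard 0
-- never ends, so nothing is contributed to the denotation.
checkᵗ : Term ops → Term ops
checkᵗ N = new 1 (seq (assign (` 1) N)
  (ifzero (add (sub (deref (` 0)) (deref (` 1))) (sub (deref (` 1)) (deref (` 0))))
    skip (while (num 0) skip)))

module _ {Γ} (u : Unique (1 ∷ 0 ∷ dom Γ)) where

  private
    Γ₀ Γ₁ : Ctx
    Γ₀ = (0 , var) ∷ Γ
    Γ₁ = (1 , var) ∷ Γ₀

    u₀ : Unique (dom Γ₀)
    u₀ = tail-unique u

    ⊢0 : _⊢_∶_ {ops} Γ₁ (` 0) var
    ⊢0 = ⊢weak (∉-head u) (⊢head u₀)

    ⊢1 : _⊢_∶_ {ops} Γ₁ (` 1) var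
    ⊢1 = ⊢head u

    ⊢numᶜ : ∀ n → _⊢_∶_ {ops} Γ₁ (num n) nat
    ⊢numᶜ n = ⊢closed u (⊢num n)

    module _ {ks : Layout Γ} {ops : Operations} where
      ref₀ : Ref (cell ∷ cell ∷ ks) (⊢0 {ops}) _ _
      ref₀ = ref-weak ref-head

      ref₁ : Ref (cell ∷ cell ∷ ks) (⊢1 {ops}) _ _
      ref₁ = ref-head

      !₀ : Pure (cell ∷ cell ∷ ks) (⊢deref (⊢0 {ops})) _
      !₀ = pure-deref ref₀

      !₁ : Pure (cell ∷ cell ∷ ks) (⊢deref (⊢1 {ops})) _
      !₁ = pure-deref ref₁

  -- A loop continues on 0, and 1 ∸ n is 0 exactly when n is positive, so the body runs until the
  -- counter in cell 1 is exhausted.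
  ⊢guard : Γ₁ ⊢ sub {ops} (num 1) (deref (` 1)) ∶ nat
  ⊢guard = ⊢sub (⊢numᶜ 1) (⊢deref ⊢1)

  ⊢body : Γ₁ ⊢ seq (assign (` 1) (sub {ops} (deref (` 1)) (num 1)))
                   (assign (` 0) (add (deref (` 0)) (deref (` 0)))) ∶ comm
  ⊢body = ⊢seq comm (⊢assign ⊢1 (⊢sub (⊢deref ⊢1) (⊢numᶜ 1)))
                    (⊢assign ⊢0 (⊢add (⊢deref ⊢0) (⊢deref ⊢0)))

  ⊢doubling : Γ₁ ⊢ doublingᵗ {ops} ∶ comm
  ⊢doubling = ⊢while ⊢guard ⊢body

  effect-doubling : ∀ {ks : Layout Γ} →
    Effect {ops = ops} (cell ∷ cell ∷ ks) ⊢doubling (λ (n , m , σ) → 0 , double n m , σ)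
  effect-doubling {ops = ops} {ks} = record
    { effect⁻ = λ r → loop⁻ (run-while⁻ r)
    ; effect⁺ = λ (n , m , σ) → run-while⁺ (loop⁺ n m σ)
    }
    where
    guard : Pure (cell ∷ cell ∷ ks) ⊢guard _
    guard = pure-sub {ops = ops} pure-num !₁

    body : Effect (cell ∷ cell ∷ ks) (⊢body {ops}) _
    body = effect-seq (effect-assign ref₁ (pure-sub !₁ pure-num))
                      (effect-assign ref₀ (pure-add !₀ !₀))

    loop⁻ : ∀ {n m σ τ} → Loop {ops = ops} (cell ∷ cell ∷ ks) ⊢guard ⊢body (n , m , σ) τ →
            τ ≡ (0 , double n m , σ)
    loop⁻ {zero}  (stop _ r) = sym (proj₂ (pure⁻ guard r))
    loop⁻ {zero}  (again r _ _) with () ← proj₁ (pure⁻ guard r)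
    loop⁻ {suc n} (stop ≢0 r) = ⊥-elim (≢0 (trans (proj₁ (pure⁻ guard r)) (0∸n≡0 n)))
    loop⁻ {suc n} (again r r′ l)
      with _ , refl ← pure⁻ guard r
      with refl ← effect⁻ body r′ = loop⁻ l

    loop⁺ : ∀ n m σ →
            Loop {ops = ops} (cell ∷ cell ∷ ks) ⊢guard ⊢body (n , m , σ) (0 , double n m , σ)
    loop⁺ zero    m σ = stop (λ ()) (pure⁺ guard refl)
    loop⁺ (suc n) m σ =
      again (pure⁺ guard (sym (0∸n≡0 n))) (effect⁺ body _)
            (loop⁺ n (m + m) σ)

  ⊢push : Γ₀ ⊢ N ∶ nat → Γ₀ ⊢ pushᵗ N ∶ comm
  ⊢push d = ⊢new (inj₁ refl) (⊢seq comm (⊢assign ⊢1 (⊢weak (∉-head u) d))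
    (⊢seq comm (⊢assign ⊢0 (⊢add (⊢numᶜ 1) (⊢add (⊢deref ⊢0) (⊢deref ⊢0)))) ⊢doubling))

  -- `k` is the content of cell 0 once `d` has run; the new code is built on it rather than on `m`.
  run-push : ∀ {ops} {N : Term ops} {ks : Layout Γ} {d : Γ₀ ⊢ N ∶ nat} {m m′ σ τ} →
             Run (cell ∷ ks) (⊢push d) (m , σ) tt (m′ , τ) ⇔
             (∃[ k ] ∃[ n ] Run (cell ∷ ks) d (m , σ) n (k , τ) × m′ ≡ code k n)
  run-push {ops} {_} {ks} {d} = mk⇔ push⁻ push⁺
    where
    encode : Effect (cell ∷ cell ∷ ks) _ (λ (n , m , σ) → 0 , code m n , σ)
    encode = effect-seq {bt = comm}
      (effect-assign (ref₀ {ops = ops}) (pure-add pure-num (pure-add !₀ !₀))) effect-doubling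

    push⁻ : ∀ {m m′ σ τ} → Run (cell ∷ ks) (⊢push d) (m , σ) tt (m′ , τ) →
            ∃[ k ] ∃[ n ] Run (cell ∷ ks) d (m , σ) n (k , τ) × m′ ≡ code k n
    push⁻ r
      with _ , r ← to run-new r
      with _ , r₁ , r₂ ← to run-seq r
      with n , _ , r₃ , r₄ ← to run-assign r₁
      with _ , r₅ ← to run-weak r₃
      with refl ← write⁻ ref₁ r₄
      with refl ← effect⁻ encode r₂ = _ , n , r₅ , refl

    push⁺ : ∀ {m m′ σ τ} → ∃[ k ] ∃[ n ] Run (cell ∷ ks) d (m , σ) n (k , τ) × m′ ≡ code k n →
            Run (cell ∷ ks) (⊢push d) (m , σ) tt (m′ , τ)
    push⁺ (_ , _ , r , refl) = from run-new (_ , from run-seq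
      ( _ , from run-assign (_ , _ , from run-weak (refl , r) , write⁺ ref₁ _ _)
      , effect⁺ encode _))

  ⊢check : Γ₀ ⊢ N ∶ nat → Γ₀ ⊢ checkᵗ N ∶ comm
  ⊢check d = ⊢new (inj₁ refl) (⊢seq comm (⊢assign ⊢1 (⊢weak (∉-head u) d))
    (⊢ifzero comm (⊢add (⊢sub (⊢deref ⊢0) (⊢deref ⊢1)) (⊢sub (⊢deref ⊢1) (⊢deref ⊢0)))
      (⊢closed u ⊢skip) (⊢while (⊢numᶜ 0) (⊢closed u ⊢skip))))

  -- The comparison leaves cell 0 alone, so the number returned by `d` must be the content `m′` that
  -- `d` leaves there.
  run-check : ∀ {ops} {N : Term ops} {ks : Layout Γ} {d : Γ₀ ⊢ N ∶ nat} {m m′ σ τ} →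
              Run (cell ∷ ks) (⊢check d) (m , σ) tt (m′ , τ) ⇔
              Run (cell ∷ ks) d (m , σ) m′ (m′ , τ)
  run-check {ops} {_} {ks} {d} = mk⇔ check⁻ check⁺
    where
    distance : Pure (cell ∷ cell ∷ ks) _ _
    distance = pure-add {ops = ops} (pure-sub !₀ !₁) (pure-sub !₁ !₀)

    distance≡0 : ∀ m n → 0 ≡ (m ∸ n) + (n ∸ m) → m ≡ n
    distance≡0 m n e = ≤-antisym
      (m∸n≡0⇒m≤n (m+n≡0⇒m≡0 (m ∸ n) (sym e)))
      (m∸n≡0⇒m≤n (m+n≡0⇒n≡0 (m ∸ n) (sym e)))

    -- A run is finite, so it would have to reach a `stop`, where the guard 0 would be nonzero.
    diverges : ∀ {σ τ} → Loop {ops = ops} (cell ∷ cell ∷ ks) (⊢numᶜ 0) (⊢closed u ⊢skip) σ τ → ⊥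
    diverges (stop ≢0 r)   = ≢0 (proj₁ (pure⁻ pure-num r))
    diverges (again _ _ l) = diverges l

    check⁻ : ∀ {m m′ σ τ} → Run (cell ∷ ks) (⊢check d) (m , σ) tt (m′ , τ) →
             Run (cell ∷ ks) d (m , σ) m′ (m′ , τ)
    check⁻ r
      with _ , r ← to run-new r
      with _ , r₁ , r₂ ← to run-seq r
      with n , (_ , k , _) , r₃ , r₄ ← to run-assign r₁
      with refl , r₅ ← to run-weak r₃
      with refl ← write⁻ ref₁ r₄
      with to run-ifzero r₂
    ... | nonZero _ _ l = ⊥-elim (diverges (run-while⁻ l))
    ... | isZero r₆ r₇
      with e , refl ← pure⁻ distance r₆
      with refl ← distance≡0 k n e
      with _ , refl ← to (run-closed {ks = cell ∷ cell ∷ ks} {u}) r₇ = r₅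

    check⁺ : ∀ {m m′ σ τ} → Run (cell ∷ ks) d (m , σ) m′ (m′ , τ) →
             Run (cell ∷ ks) (⊢check d) (m , σ) tt (m′ , τ)
    check⁺ {m′ = m′} r = from run-new (_ , from run-seq
      ( _ , from run-assign (_ , _ , from run-weak (refl , r) , write⁺ ref₁ _ _)
      , from run-ifzero (isZero
          (pure⁺ distance (sym (cong₂ _+_ (n∸n≡0 m′) (n∸n≡0 m′))))
          (from (run-closed {ks = cell ∷ cell ∷ ks} {u}) (tt , refl)))))

-- The returned random number is also pushed onto the code in cell 0, which
-- thereby records the sequence of numbers produced so far.
guessᵗ : Term ops
guessᵗ = new 2 (seq (assign (` 2) random) (seq (pushᵗ (deref (` 2))) (deref (` 2))))

-- Subtracting 0 serves to order the effects: the guess comes first and is the result, and the check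
-- comes second, when the guess is already part of the code.
confirmᵗ : Term ops → Term ops
confirmᵗ N = sub guessᵗ (seq (checkᵗ N) (num 0))

module _ {Γ} (u : Unique (1 ∷ 0 ∷ 2 ∷ dom Γ)) where

  private
    u₀₂ : Unique (0 ∷ 2 ∷ dom Γ)
    u₀₂ = tail-unique u

    u₂ : Unique (2 ∷ dom Γ)
    u₂ = tail-unique u₀₂

    ⊢2 : _⊢_∶_ {ops} ((0 , var) ∷ (2 , var) ∷ Γ) (` 2) var
    ⊢2 = ⊢weak (∉-head u₀₂) (⊢head u₂)

    ref₂ : ∀ {ops} {ks : Layout Γ} → Ref (cell ∷ cell ∷ ks) (⊢2 {ops}) _ _
    ref₂ = ref-weak ref-head

    !₂ : ∀ {ops} {ks : Layout Γ} → Pure (cell ∷ cell ∷ ks) (⊢deref (⊢2 {ops})) _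
    !₂ = pure-deref ref₂

  ⊢guess : _⊢_∶_ {ops} ((0 , var) ∷ Γ) guessᵗ nat
  -- The exchange moves cell 0 to the head, where `⊢push` expects it.
  ⊢guess = ⊢new (inj₂ refl) (⊢exch (swap _ _ refl)
    (⊢seq nat (⊢assign ⊢2 (⊢random u₀₂)) (⊢seq nat (⊢push u (⊢deref ⊢2)) (⊢deref ⊢2))))

  -- Every `n` is possible: cell 2 only makes one random number available twice, for the code and as
  -- the result.
  run-guess : ∀ {ops} {ks : Layout Γ} {m m′ n σ τ} →
              Run {ops = ops} (cell ∷ ks) ⊢guess (m , σ) n (m′ , τ) ⇔ (m′ ≡ code m n × σ ≡ τ)
  run-guess {ops} {ks} = mk⇔ guess⁻ guess⁺
    where
    guess⁻ : ∀ {m m′ n σ τ} → Run {ops = ops} (cell ∷ ks) ⊢guess (m , σ) n (m′ , τ) →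
             m′ ≡ code m n × σ ≡ τ
    guess⁻ r
      with _ , r ← to run-new r
      with _ , r₁ , r₂ ← to run-seq (to run-swap r)
      with _ , _ , r₃ , r₄ ← to run-assign r₁
      with refl ← to run-random r₃
      with refl ← write⁻ ref₂ r₄
      with _ , r₅ , r₆ ← to run-seq r₂
      with _ , _ , r₇ , e ← to (run-push u) r₅
      with refl , refl ← pure⁻ !₂ r₇
      with refl , refl ← pure⁻ !₂ r₆ = e , refl

    guess⁺ : ∀ {m m′ n σ τ} → m′ ≡ code m n × σ ≡ τ →
             Run {ops = ops} (cell ∷ ks) ⊢guess (m , σ) n (m′ , τ)
    guess⁺ (refl , refl) = from run-new (_ , from run-swap (from run-seq
      ( _ , from run-assign (_ , _ , from run-random refl , write⁺ ref₂ _ _)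
      , from run-seq
        (_ , from (run-push u) (_ , _ , pure⁺ !₂ refl , refl) , pure⁺ !₂ refl))))

module _ {Γ} (u : Unique (1 ∷ 0 ∷ 2 ∷ dom Γ)) (u′ : Unique (1 ∷ 0 ∷ dom Γ)) where

  ⊢confirm : (0 , var) ∷ Γ ⊢ N ∶ nat → (0 , var) ∷ Γ ⊢ confirmᵗ N ∶ nat
  ⊢confirm d = ⊢sub (⊢guess u) (⊢seq nat (⊢check u′ d) (⊢closed (tail-unique u′) (⊢num 0)))

  run-confirm : ∀ {ops} {N : Term ops} {ks : Layout Γ} {d : (0 , var) ∷ Γ ⊢ N ∶ nat}
                {m m′ n σ τ} →
                Run (cell ∷ ks) (⊢confirm d) (m , σ) n (m′ , τ) ⇔
                Run (cell ∷ ks) d (code m n , σ) m′ (m′ , τ)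
  run-confirm {ops} {_} {ks} {d} = mk⇔ confirm⁻ confirm⁺
    where
    confirm⁻ : ∀ {m m′ n σ τ} → Run (cell ∷ ks) (⊢confirm d) (m , σ) n (m′ , τ) →
               Run (cell ∷ ks) d (code m n , σ) m′ (m′ , τ)
    confirm⁻ r
      with _ , _ , _ , r₁ , r₂ , e ← to run-arith r
      with refl , refl ← to (run-guess u) r₁
      with _ , r₃ , r₄ ← to run-seq r₂
      with refl , refl ← pure⁻ pure-num r₄
      with refl ← trans e (eval-minus ops _ 0) = to (run-check u′) r₃

    confirm⁺ : ∀ {m m′ n σ τ} → Run (cell ∷ ks) d (code m n , σ) m′ (m′ , τ) →
               Run (cell ∷ ks) (⊢confirm d) (m , σ) n (m′ , τ)
    confirm⁺ r = from run-arith (_ , _ , _ , from (run-guess u) (refl , refl)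
      , from run-seq (_ , from (run-check u′) r , pure⁺ pure-num refl)
      , sym (eval-minus ops _ 0))

-- Closed terms that use their argument exactly once

∙-identityʳ : (t : Traces Γ) → t ∙ ε ≡ t
∙-identityʳ []      = refl
∙-identityʳ (s ∷ t) = cong₂ _∷_ (++-identityʳ s) (∙-identityʳ t)

-- A denotation supported on one-letter argument traces amounts to a relation between elements, and
-- composing terms then composes relations.
record Linear {M : Term ops} (d : [] ⊢ M ∶ A ⊸ B) (R : α A → α B → Set) : Set where
  constructor linear
  field
    uses-once : ∀ {s b} → ⟦ d ⟧ [] (s , b) ⇔ (∃[ a ] s ≡ [ a ] × R a b)

open Linear

⊢apply : [] ⊢ M ∶ A ⊸ B → Γ ⊢ N ∶ A → Γ ⊢ M · N ∶ B
⊢apply = ⊢app (λ { (() , _) })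

module _ {M : Term ops} {d : [] ⊢ M ∶ A ⊸ B} {R : α A → α B → Set} (ℓ : Linear d R)
         {N : Term ops} (e : Γ ⊢ N ∶ A) where

  apply⁻ : ∀ ss {b} → ⟦ ⊢apply d e ⟧ ss b → ∃[ a ] ⟦ e ⟧ ss a × R a b
  apply⁻ _ (_ , _ , ds , es , eq) with to (uses-once ℓ) ds | es | eq
  -- For a single call `concat` yields `t ∙ ε`, which still has to be identified with `t`.
  ... | a , refl , r | es ∷ [] | refl =
    a , subst (λ t → ⟦ e ⟧ t a) (sym (∙-identityʳ _)) es , r

  apply⁺ : ∀ ss {b} → ∃[ a ] ⟦ e ⟧ ss a × R a b → ⟦ ⊢apply d e ⟧ ss b
  apply⁺ _ (a , es , r) =
    [ a ] , _ , from (uses-once ℓ) (a , refl , r) , es ∷ [] , sym (∙-identityʳ _)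

compᵗ : Ty → Term ops → Term ops → Term ops
compᵗ A M N = ƛ 3 A (M · (N · ` 3))

⊢comp : [] ⊢ M ∶ A′ ⊸ B → [] ⊢ N ∶ A ⊸ A′ → [] ⊢ compᵗ A M N ∶ A ⊸ B
⊢comp d e = ⊢ƛ (⊢apply d (⊢apply e ⊢var))

linear-comp : {d : [] ⊢ M ∶ A′ ⊸ B} {e : [] ⊢ N ∶ A ⊸ A′} {R : α A → α A′ → Set}
              {S : α A′ → α B → Set} → Linear d S → Linear e R →
              Linear (⊢comp d e) (λ a b → ∃[ c ] R a c × S c b)
linear-comp {e = e} ℓ ℓ′ .uses-once {s} = mk⇔
  (λ ds → let c , es , q = apply⁻ ℓ (⊢apply e ⊢var) (s ∷ []) ds
              a , eq , r = apply⁻ ℓ′ ⊢var (s ∷ []) es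
          in a , eq , c , r , q)
  (λ (a , eq , c , r , q) →
    apply⁺ ℓ (⊢apply e ⊢var) (s ∷ []) (c , apply⁺ ℓ′ ⊢var (s ∷ []) (a , eq , r) , q))

-- The action f ↦ N ∘ f ∘ M of `⊸` on closed terms, contravariant in the argument type.
arrowᵗ : Ty → Ty → Term ops → Term ops → Term ops
arrowᵗ A A′ M N = ƛ 3 A (ƛ 4 A′ (N · (` 3 · (M · ` 4))))

⊢call : [] ⊢ M ∶ A′ ⊸ A → (3 , A ⊸ B) ∷ (4 , A′) ∷ [] ⊢ ` 3 · (M · ` 4) ∶ B
⊢call d = ⊢app (λ { (here refl , here ()) }) ⊢var (⊢apply d ⊢var)

⊢arrow : [] ⊢ M ∶ A′ ⊸ A → [] ⊢ N ∶ B ⊸ B′ →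
         [] ⊢ arrowᵗ (A ⊸ B) A′ M N ∶ (A ⊸ B) ⊸ (A′ ⊸ B′)
⊢arrow d e = ⊢ƛ (⊢ƛ (⊢exch (swap _ _ refl) (⊢apply e (⊢call d))))

-- `N` uses the function once, and each call that the function makes to its argument passes through
-- `M`, which uses the outer argument once. Hence the two argument lists correspond letter by
-- letter.
linear-arrow : {d : [] ⊢ M ∶ A′ ⊸ A} {e : [] ⊢ N ∶ B ⊸ B′} {R : α A′ → α A → Set}
               {S : α B → α B′ → Set} → Linear d R → Linear e S →
               Linear (⊢arrow d e) (λ (l , b) (l′ , b′) → Pointwise R l′ l × S b b′)
linear-arrow {A′ = A′} {d = d} {R = R} ℓ ℓ′ .uses-once {s} {l′ , b′} = mk⇔
  (λ ds → let b , (as , ts , e , es , eq) , q = apply⁻ ℓ′ (⊢call d) (s ∷ l′ ∷ []) ds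
          in (as , b) , e , concat⁻ es eq , q)
  (λ { ((l , b) , e , rs , q) →
       let ts , es , eq = concat⁺ rs
       in apply⁺ ℓ′ (⊢call d) (s ∷ l′ ∷ []) (b , (l , ts , e , es , eq) , q) })
  where
  arg : Traces ((4 , A′) ∷ []) → α _ → Set
  arg = ⟦ ⊢apply d ⊢var ⟧

  -- Stated for a variable `t`, because `concat ts` does not reduce to its single component.
  split : ∀ {l r} (t : Traces ((4 , A′) ∷ [])) → l ∷ [] ≡ (r ∷ []) ∙ t →
          ∃[ l′ ] l ≡ r ++ l′ × t ≡ l′ ∷ []
  split (_ ∷ []) refl = _ , refl , refl

  concat⁻ : ∀ {l as ts} → Pointwise arg ts as → l ∷ [] ≡ concat ts → Pointwise R l as
  concat⁻ []                  refl = []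
  concat⁻ {ts = (_ ∷ []) ∷ ts} (r ∷ rs) e
    with _ , refl , q ← apply⁻ ℓ ⊢var (_ ∷ []) r
    with _ , refl , e′ ← split (concat ts) e = q ∷ concat⁻ rs (sym e′)

  concat⁺ : ∀ {l as} → Pointwise R l as → ∃[ ts ] Pointwise arg ts as × l ∷ [] ≡ concat ts
  concat⁺ []       = [] , [] , refl
  concat⁺ (q ∷ qs) =
    let ts , rs , eq = concat⁺ qs
    in _ , apply⁺ ℓ ⊢var (_ ∷ []) (_ , refl , q) ∷ rs , cong (([ _ ] ∷ []) ∙_) eq

-- Retracts

-- The section denotes `Code` and the retraction its converse. Totality lets every element survive
-- the round trip, and injectivity makes it return as itself only.
record Retract (ops : Operations) (A B : Ty) : Set₁ where
  field
    Code       : α A → α B → Set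
    total      : ∀ a → ∃[ b ] Code a b
    injective  : ∀ {a a′ b} → Code a b → Code a′ b → a ≡ a′
    {secᵗ retᵗ} : Term ops
    ⊢sec       : [] ⊢ secᵗ ∶ A ⊸ B
    ⊢ret       : [] ⊢ retᵗ ∶ B ⊸ A
    sec-linear : Linear ⊢sec Code
    ret-linear : Linear ⊢ret (flip Code)

open Retract

total* : (r : Retract ops A B) (as : List (α A)) → ∃[ bs ] Pointwise (Code r) as bs
total* r []       = [] , []
total* r (a ∷ as) =
  let b , p = total r a
      bs , ps = total* r as
  in b ∷ bs , p ∷ ps

injective* : (r : Retract ops A B) {as as′ : List (α A)} {bs : List (α B)} →
             Pointwise (Code r) as bs → Pointwise (flip (Code r)) bs as′ → as ≡ as′
injective* r ps qs = Pointwise-≡⇒≡ (transitive (injective r) ps qs)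

_⊚_ : Retract ops A′ B → Retract ops A A′ → Retract ops A B
r ⊚ r′ = record
  { Code       = λ a b → ∃[ c ] Code r′ a c × Code r c b
  ; total      = λ a → let c , p = total r′ a
                           b , q = total r c
                       in b , c , p , q
  ; injective  = λ { (_ , p , q) (_ , p′ , q′) → injective′ p q p′ q′ }
  ; ⊢sec       = ⊢comp (⊢sec r) (⊢sec r′)
  ; ⊢ret       = ⊢comp (⊢ret r′) (⊢ret r)
  ; sec-linear = linear-comp (sec-linear r) (sec-linear r′)
  ; ret-linear = linear (mk⇔
      (λ ds → let b , e , c , q , p = to (uses-once ret-comp) ds in b , e , c , p , q)
      (λ (b , e , c , p , q) → from (uses-once ret-comp) (b , e , c , q , p)))
  }
  where
  ret-comp = linear-comp (ret-linear r′) (ret-linear r)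

  injective′ : ∀ {a a′ b c c′} → Code r′ a c → Code r c b → Code r′ a′ c′ → Code r c′ b → a ≡ a′
  injective′ p q p′ q′ with refl ← injective r q q′ = injective r′ p p′

-- The section decodes arguments and encodes results; the retraction does the opposite. `symmetric`
-- turns the pointwise relation on argument lists round.
arrow : Retract ops A A′ → Retract ops B B′ → Retract ops (A ⊸ B) (A′ ⊸ B′)
arrow r r′ = record
  { Code       = λ (l , b) (l′ , b′) → Pointwise (flip (Code r)) l′ l × Code r′ b b′
  ; total      = λ (l , b) → let l′ , ps = total* r l
                                 b′ , q = total r′ b
                             in (l′ , b′) , symmetric (λ p → p) ps , q
  ; injective  = λ (ps , q) (ps′ , q′) →
      cong₂ _,_ (injective* r (symmetric (λ p → p) ps) ps′) (injective r′ q q′)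
  ; ⊢sec       = ⊢arrow (⊢ret r) (⊢sec r′)
  ; ⊢ret       = ⊢arrow (⊢sec r) (⊢ret r′)
  ; sec-linear = linear-arrow (ret-linear r) (sec-linear r′)
  ; ret-linear = linear (mk⇔
      (λ ds → let a , e , ps , q = to (uses-once ret-arrow) ds in a , e , symmetric (λ p → p) ps , q)
      (λ (a , e , ps , q) → from (uses-once ret-arrow) (a , e , symmetric (λ p → p) ps , q)))
  }
  where
  ret-arrow = linear-arrow (sec-linear r) (ret-linear r′)

-- Injectivity of the code

double-+ : ∀ n m → double n (m + m) ≡ double n m + double n m
double-+ zero    m = refl
double-+ (suc n) m = double-+ n (m + m)

m+m-injective : ∀ m n → m + m ≡ n + n → m ≡ n
m+m-injective zero    zero    _  = refl
m+m-injective (suc m) (suc n) eq =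
  cong suc (m+m-injective m n (suc-injective (trans (sym (+-suc m m))
    (trans (suc-injective eq) (+-suc n n)))))

1+m+m≢n+n : ∀ m n → 1 + (m + m) ≢ n + n
1+m+m≢n+n (suc m) (suc n) eq =
  1+m+m≢n+n m n (suc-injective (trans (cong suc (sym (+-suc m m)))
    (trans (suc-injective eq) (+-suc n n))))
1+m+m≢n+n zero (suc n) eq = 0≢1+n (trans (suc-injective eq) (+-suc n n))

-- This separates the empty sequence, whose code is 0, from all others.
code≢0 : ∀ m n → code m n ≢ 0
code≢0 m (suc n) eq = code≢0 m n (m+n≡0⇒m≡0 _ (trans (sym (double-+ n (1 + (m + m)))) eq))

-- By parity: exponent 0 gives an odd number, while a positive exponent gives twice the code with
-- the exponent lowered by one.
code-injective : ∀ m m′ n n′ → code m n ≡ code m′ n′ → m ≡ m′ × n ≡ n′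
code-injective m m′ zero    zero     eq = m+m-injective m m′ (suc-injective eq) , refl
code-injective m m′ zero    (suc n′) eq =
  ⊥-elim (1+m+m≢n+n m (code m′ n′) (trans eq (double-+ n′ (1 + (m′ + m′)))))
code-injective m m′ (suc n) zero     eq =
  ⊥-elim (1+m+m≢n+n m′ (code m n) (trans (sym eq) (double-+ n (1 + (m + m)))))
code-injective m m′ (suc n) (suc n′) eq =
  let e , e′ = code-injective m m′ n n′ (m+m-injective (code m n) (code m′ n′)
                 (trans (sym (double-+ n (1 + (m + m))))
                   (trans eq (double-+ n′ (1 + (m′ + m′))))))
  in e , cong suc e′

codes : List ℕ → ℕ
codes = foldl code 0

-- The last number is the outermost layer of the code. Reversal turns the left fold into a right
-- fold, whose layers are peeled off from the head.
codes-injective : ∀ {l l′} → codes l ≡ codes l′ → l ≡ l′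
codes-injective {l} {l′} eq = reverse-injective (foldr-injective (reverse l) (reverse l′)
  (trans (reverse-codes l) (trans eq (sym (reverse-codes l′)))))
  where
  reverse-codes : ∀ l → foldr (flip code) 0 (reverse l) ≡ codes l
  reverse-codes = reverse-foldr (flip code) 0

  foldr-injective : ∀ l l′ → foldr (flip code) 0 l ≡ foldr (flip code) 0 l′ → l ≡ l′
  foldr-injective []      []        _  = refl
  foldr-injective []      (n ∷ l′)  eq = ⊥-elim (code≢0 (foldr (flip code) 0 l′) n (sym eq))
  foldr-injective (n ∷ l) []        eq = ⊥-elim (code≢0 (foldr (flip code) 0 l) n eq)
  foldr-injective (n ∷ l) (n′ ∷ l′) eq =
    let e , e′ = code-injective _ _ n n′ eq in cong₂ _∷_ e′ (foldr-injective l l′ e)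

-- Retracts of nat

tapes : Layout Γ
tapes {[]}    = []
tapes {_ ∷ _} = tape ∷ tapes

load : Traces Γ → State (tapes {Γ})
load []       = tt
load (s ∷ ss) = s , load ss

load-moves⁻ : (ss ts : Traces Γ) → Moves* tapes (load ss) ts (load ε) → ss ≡ ts
load-moves⁻ []       []       _        = refl
load-moves⁻ (s ∷ ss) (t ∷ ts) (m , ms) =
  cong₂ _∷_ (trans m (++-identityʳ t)) (load-moves⁻ ss ts ms)

load-moves⁺ : (ss : Traces Γ) → Moves* tapes (load ss) ss (load ε)
load-moves⁺ []       = tt
load-moves⁺ (s ∷ ss) = sym (++-identityʳ s) , load-moves⁺ ss

-- Loading the whole trace onto tapes and requiring them to end empty forces a run to use exactly
-- that trace.
denotes⇔run : {d : Γ ⊢ M ∶ B} {ss : Traces Γ} {b : α B} →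
              ⟦ d ⟧ ss b ⇔ Run tapes d (load ss) b (load ε)
denotes⇔run {d = d} {ss} {b} = mk⇔
  (λ ds → run ds (load-moves⁺ ss))
  (λ { (run {ts} ds ms) → subst (λ ss → ⟦ d ⟧ ss b) (sym (load-moves⁻ ss ts ms)) ds })

linear-run : {d : (x , A) ∷ [] ⊢ M ∶ B} {R : α A → α B → Set} →
             (∀ {s b} → Run tapes d (s , tt) b ([] , tt) ⇔ (∃[ a ] s ≡ [ a ] × R a b)) →
             Linear (⊢ƛ d) R
linear-run h .uses-once = mk⇔ (to h ∘ to denotes⇔run) (from denotes⇔run ∘ from h)

module _ {A : Ty} where

  private
    Γ₁ : Ctx
    Γ₁ = (0 , var) ∷ (4 , A) ∷ []

    Γ₂ : Ctx
    Γ₂ = (0 , var) ∷ (3 , nat) ∷ (4 , A) ∷ []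

  ⊢x : _⊢_∶_ {ops} Γ₁ (` 4) A
  ⊢x = ⊢weak (λ { (here ()) }) ⊢var

  run-x : ∀ {m m′ s s′ a} → Run {ops = ops} (cell ∷ tapes) ⊢x (m , s , tt) a (m′ , s′ , tt) ⇔
          (m ≡ m′ × s ≡ a ∷ s′)
  run-x = mk⇔
    (λ { (run {_ ∷ _ ∷ []} (refl , refl) (e , e′ , _)) → e , e′ })
    (λ (e , e′) → run {trace = _ ∷ _ ∷ []} (refl , refl) (e , e′ , tt))

  ⊢z : _⊢_∶_ {ops} Γ₂ (` 3) nat
  ⊢z = ⊢weak (λ { (here ()) ; (there (here ())) }) (⊢head (toWitness {a? = unique? _} tt))

  run-z : ∀ {m m′ s s′ t t′ n} →
          Run {ops = ops} (cell ∷ tapes) ⊢z (m , s , t , tt) n (m′ , s′ , t′ , tt) ⇔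
          (m ≡ m′ × s ≡ n ∷ s′ × t ≡ t′)
  run-z = mk⇔
    (λ { (run {_ ∷ _ ∷ _ ∷ []} (refl , refl , refl) (e , e′ , e″ , _)) → e , e′ , e″ })
    (λ (e , e′ , e″) → run {trace = _ ∷ _ ∷ _ ∷ []} (refl , refl , refl) (e , e′ , e″ , tt))

  ⊢y : _⊢_∶_ {ops} Γ₂ (` 4) A
  ⊢y = ⊢weak (λ { (here ()) ; (there (here ())) }) (⊢weak (λ { (here ()) }) ⊢var)

  run-y : ∀ {m m′ s s′ t t′ a} →
          Run {ops = ops} (cell ∷ tapes) ⊢y (m , s , t , tt) a (m′ , s′ , t′ , tt) ⇔
          (m ≡ m′ × s ≡ s′ × t ≡ a ∷ t′)
  run-y = mk⇔
    (λ { (run {_ ∷ _ ∷ _ ∷ []} (refl , refl , refl) (e , e′ , e″ , _)) → e , e′ , e″ })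
    (λ (e , e′ , e″) → run {trace = _ ∷ _ ∷ _ ∷ []} (refl , refl , refl) (e , e′ , e″ , tt))

-- Abstract, because unification would otherwise unfold these proofs inside typing
-- derivations at a prohibitive cost.
abstract
  u₂₄ : Unique (1 ∷ 0 ∷ 2 ∷ 4 ∷ [])
  u₂₄ = toWitness {a? = unique? _} tt

  u₄ : Unique (1 ∷ 0 ∷ 4 ∷ [])
  u₄ = toWitness {a? = unique? _} tt

  u₂ : Unique (1 ∷ 0 ∷ 2 ∷ [])
  u₂ = toWitness {a? = unique? _} tt

  u₃₄ : Unique (1 ∷ 0 ∷ 3 ∷ 4 ∷ [])
  u₃₄ = toWitness {a? = unique? _} tt

  u₂₃₄ : Unique (1 ∷ 0 ∷ 2 ∷ 3 ∷ 4 ∷ [])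
  u₂₃₄ = toWitness {a? = unique? _} tt

-- The base types as retracts of `nat`.

nat-retract : Retract ops nat nat
nat-retract = record
  { Code       = _≡_
  ; total      = λ n → n , refl
  ; injective  = λ { refl refl → refl }
  ; ⊢sec       = ⊢ƛ {x = 4} ⊢var
  ; ⊢ret       = ⊢ƛ {x = 4} ⊢var
  ; sec-linear = linear (mk⇔ (λ e → _ , e , refl) (λ { (_ , e , refl) → e }))
  ; ret-linear = linear (mk⇔ (λ e → _ , e , refl) (λ { (_ , e , refl) → e }))
  }

comm-retract : Retract ops comm nat
comm-retract = record
  { Code       = λ _ n → n ≡ 0
  ; total      = λ _ → 0 , refl
  ; injective  = λ _ _ → refl
  ; ⊢sec       = ⊢ƛ {x = 4} (⊢seq nat ⊢var (⊢weak (λ ()) (⊢num 0)))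
  -- The new cell holds 0, so the check accepts exactly the input 0.
  ; ⊢ret       = ⊢ƛ {x = 4} (⊢new (inj₁ refl) (⊢check u₄ ⊢x))
  ; sec-linear = linear (mk⇔
      (λ { (_ ∷ [] , _ ∷ [] , refl , refl , refl , e) → _ , refl , e })
      (λ { (_ , refl , e) → [ _ ] ∷ [] , [] ∷ [] , refl , refl , refl , e }))
  ; ret-linear = linear-run (mk⇔
      (λ r → let _ , r′ = to run-new r
                 e , e′ = to run-x (to (run-check u₄) r′)
             in _ , e′ , sym e)
      (λ (_ , e , e′) → from run-new (_ , from (run-check u₄) (from run-x (sym e′ , e)))))
  }

tag : Action → ℕ
tag (read n)  = code 0 n
tag (write n) = code 1 n

tag-injective : ∀ a a′ → tag a ≡ tag a′ → a ≡ a′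
tag-injective (read n)  (read n′)  eq = cong read (proj₂ (code-injective 0 0 n n′ eq))
tag-injective (write n) (write n′) eq = cong write (proj₂ (code-injective 1 1 n n′ eq))
tag-injective (read n)  (write n′) eq with () ← proj₁ (code-injective 0 1 n n′ eq)
tag-injective (write n) (read n′)  eq with () ← proj₁ (code-injective 1 0 n n′ eq)

module VarRetract {ops : Operations} where

  -- A random choice decides whether to read or to write. Cell 0 starts at the marker 0 of a read;
  -- before a write it is set to 1, and the number written is the one that `guessᵗ` records.
  ⊢act : (0 , var) ∷ (4 , var) ∷ [] ⊢ ifzero random (pushᵗ (deref (` 4)))
           (seq (assign (` 0) (num 1)) (assign (` 4) (guessᵗ {ops}))) ∶ comm
  ⊢act = ⊢ifzero comm (⊢random (tail-unique u₄)) (⊢push u₄ (⊢deref ⊢x))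
    (⊢seq comm (⊢assign (⊢head (tail-unique u₄)) (⊢closed (tail-unique u₄) (⊢num 1)))
               (⊢assign ⊢x (⊢guess u₂₄)))

  set-1 : ∀ {Γ} {ks : Layout Γ} {u : Unique (0 ∷ dom Γ)} →
          Effect {ops = ops} (cell ∷ ks) (⊢assign (⊢head u) (⊢closed u (⊢num 1)))
            (λ (_ , σ) → 1 , σ)
  set-1 = effect-assign ref-head pure-num

  run-act : ∀ {n s s′} → Run (cell ∷ tapes) ⊢act (0 , s , tt) tt (n , s′ , tt) ⇔
            (∃[ a ] s ≡ a ∷ s′ × n ≡ tag a)
  run-act = mk⇔ act⁻ act⁺
    where
    act⁻ : ∀ {n s s′} → Run (cell ∷ tapes) ⊢act (0 , s , tt) tt (n , s′ , tt) →
           ∃[ a ] s ≡ a ∷ s′ × n ≡ tag a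
    act⁻ r with to run-ifzero r
    ... | isZero r₁ r₂
      with refl ← to run-random r₁
      with _ , n , r₃ , e ← to (run-push u₄) r₂
      with refl , e′ ← to run-x (to run-deref r₃) = read n , e′ , e
    ... | nonZero _ r₁ r₂
      with refl ← to run-random r₁
      with _ , r₃ , r₄ ← to run-seq r₂
      with refl ← effect⁻ set-1 r₃
      with n , _ , r₅ , r₆ ← to run-assign r₄
      with refl , refl ← to (run-guess u₂₄) r₅
      with refl , e ← to run-x r₆ = write n , e , refl

    act⁺ : ∀ {n s s′} → ∃[ a ] s ≡ a ∷ s′ × n ≡ tag a →
           Run (cell ∷ tapes) ⊢act (0 , s , tt) tt (n , s′ , tt)
    act⁺ (read n , e , e′) = from run-ifzero (isZero (from run-random refl)
      (from (run-push u₄) (0 , n , from run-deref (from run-x (refl , e)) , e′)))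
    -- Any nonzero random number selects the writing branch; 1 is taken.
    act⁺ (write n , e , refl) = from run-ifzero (nonZero (λ ()) (from (run-random {n = 1}) refl)
      (from run-seq (_ , effect⁺ set-1 _ , from run-assign
        (n , _ , from (run-guess u₂₄) (refl , refl) , from run-x (refl , e)))))

  -- The cell is set to the marker 1 and the number to be written is pushed onto it; the input must
  -- equal the resulting code.
  ⊢write : (3 , nat) ∷ (4 , nat) ∷ [] ⊢
           new 0 (seq (assign (` 0) (num 1)) (seq (pushᵗ (` 3)) (checkᵗ {ops} (` 4)))) ∶ comm
  ⊢write = ⊢new (inj₁ refl)
    (⊢seq comm (⊢assign (⊢head (tail-unique u₃₄)) (⊢closed (tail-unique u₃₄) (⊢num 1)))
      (⊢seq comm (⊢push u₃₄ ⊢z) (⊢check u₃₄ ⊢y)))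

  run-write : ∀ {s t} → Run tapes ⊢write (s , t , tt) tt ([] , [] , tt) ⇔
              (∃[ n ] s ≡ [ n ] × t ≡ [ tag (write n) ])
  run-write = mk⇔ write-run⁻ write-run⁺
    where
    write-run⁻ : ∀ {s t} → Run tapes ⊢write (s , t , tt) tt ([] , [] , tt) →
              ∃[ n ] s ≡ [ n ] × t ≡ [ tag (write n) ]
    write-run⁻ r
      with _ , r ← to run-new r
      with _ , r₁ , r₂ ← to run-seq r
      with refl ← effect⁻ set-1 r₁
      with _ , r₃ , r₄ ← to run-seq r₂
      with _ , n , r₅ , refl ← to (run-push u₃₄) r₃
      with refl , refl , refl ← to run-z r₅
      with refl , refl , e ← to run-y (to (run-check u₃₄) r₄) = n , refl , e

    write-run⁺ : ∀ {s t} → ∃[ n ] s ≡ [ n ] × t ≡ [ tag (write n) ] →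
              Run tapes ⊢write (s , t , tt) tt ([] , [] , tt)
    write-run⁺ (n , e , e′) = from run-new (_ , from run-seq (_ , effect⁺ set-1 _ ,
      from run-seq (_ , from (run-push u₃₄) (_ , n , from run-z (refl , e , refl) , refl) ,
        from (run-check u₃₄) (from run-y (refl , refl , e′)))))

  -- The new cell holds 0, the marker of a read, so a guess `n` is confirmed against `tag (read n)`.
  ⊢read : (4 , nat) ∷ [] ⊢ new 0 (confirmᵗ {ops} (` 4)) ∶ nat
  ⊢read = ⊢new (inj₂ refl) (⊢confirm u₂₄ u₄ ⊢x)

  run-read : ∀ {s n} → Run tapes ⊢read (s , tt) n ([] , tt) ⇔ s ≡ [ tag (read n) ]
  run-read = mk⇔
    (λ r → let _ , r′ = to run-new r in reads (to run-x (to (run-confirm u₂₄ u₄) r′)))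
    (λ e → from run-new (_ , from (run-confirm u₂₄ u₄) (from run-x (refl , e))))
    where
    reads : ∀ {m n} {s : List ℕ} → m ≡ n × s ≡ n ∷ [] → s ≡ [ m ]
    reads (refl , e) = e

  ⊢sec-body : (4 , var) ∷ [] ⊢ new 0 (seq _ (deref (` 0))) ∶ nat
  ⊢sec-body = ⊢new (inj₂ refl) (⊢seq nat ⊢act (⊢deref (⊢head (tail-unique u₄))))

  run-sec : ∀ {s n} → Run tapes ⊢sec-body (s , tt) n ([] , tt) ⇔ (∃[ a ] s ≡ [ a ] × n ≡ tag a)
  run-sec = mk⇔ sec⁻ (λ p → from run-new (_ , from run-seq
      (_ , from run-act p , pure⁺ (pure-deref ref-head) refl)))
    where
    sec⁻ : ∀ {s n} → Run tapes ⊢sec-body (s , tt) n ([] , tt) → ∃[ a ] s ≡ [ a ] × n ≡ tag a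
    sec⁻ r
      with _ , r ← to run-new r
      with _ , r₁ , r₂ ← to run-seq r
      with refl , refl ← pure⁻ (pure-deref ref-head) r₂ = to run-act r₁

  var-retract : Retract ops var nat
  var-retract = record
    { Code       = λ a n → n ≡ tag a
    ; total      = λ a → tag a , refl
    ; injective  = λ {a} {a′} e e′ → tag-injective a a′ (trans (sym e) e′)
    ; ⊢sec       = ⊢ƛ ⊢sec-body
    ; ⊢ret       = ⊢ƛ (⊢mkvar (⊢ƛ ⊢write) ⊢read)
    ; sec-linear = linear-run run-sec
    ; ret-linear = linear (λ {_} {a} → mk⇔ (ret⁻ a) (ret⁺ a))
    }
    where
    ret⁻ : ∀ a {s} → ⟦ ⊢mkvar (⊢ƛ ⊢write) ⊢read ⟧ (s ∷ []) a → ∃[ n ] s ≡ [ n ] × n ≡ tag a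
    ret⁻ (read n)  ds       = _ , to run-read (to denotes⇔run ds) , refl
    -- The writing term reads its argument once, so `replicate k n` has length 1, which forces `k`
    -- to be 1.
    ret⁻ (write n) (k , ds) with k | to run-write (to denotes⇔run ds)
    ... | 1 | _ , refl , e = _ , e , refl

    ret⁺ : ∀ a {s} → ∃[ n ] s ≡ [ n ] × n ≡ tag a → ⟦ ⊢mkvar (⊢ƛ ⊢write) ⊢read ⟧ (s ∷ []) a
    ret⁺ (read n)  (_ , e , refl) = from denotes⇔run (from run-read e)
    ret⁺ (write n) (_ , e , refl) = 1 , from denotes⇔run (from run-write (n , refl , e))

-- The type `nat ⊸ nat` as a retract of `nat`.

module FunctionRetract {ops : Operations} where

  ⊢call-guess : (0 , var) ∷ (4 , nat ⊸ nat) ∷ [] ⊢ ` 4 · guessᵗ {ops} ∶ nat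
  ⊢call-guess = ⊢exch (swap _ _ refl) (⊢app (λ { (here refl , here ()) }) ⊢var (⊢guess u₂))

  -- Application concatenates the traces of the calls, so each call starts from the code left by the
  -- previous one.
  guesses⁻ : ∀ {ts l m n} → Pointwise ⟦ ⊢guess u₂ {ops} ⟧ ts l →
             Moves* (cell ∷ []) (m , tt) (concat ts) (n , tt) → n ≡ foldl code m l
  guesses⁻ []                 (e , _) = sym e
  guesses⁻ {t ∷ ts} (ds ∷ es) ms
    with _ , ms₁ , ms₂ ← moves-∙⁻ (cell ∷ []) t (concat ts) ms
    with refl , _ ← to (run-guess u₂) (run ds ms₁) = guesses⁻ es ms₂

  guesses⁺ : ∀ l {m} → ∃[ ts ] Pointwise ⟦ ⊢guess u₂ {ops} ⟧ ts l ×
             Moves* (cell ∷ []) (m , tt) (concat ts) (foldl code m l , tt)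
  guesses⁺ []      = [] , [] , refl , tt
  guesses⁺ (n ∷ l) =
    let run {t} ds ms = from (run-guess u₂ {ks = []}) (refl , refl)
        ts , es , ms′ = guesses⁺ l
    in t ∷ ts , ds ∷ es , moves-∙⁺ (cell ∷ []) t (concat ts) ms ms′

  run-call-guess : ∀ {m m′ s s′ n} →
    Run (cell ∷ tapes) ⊢call-guess (m , s , tt) n (m′ , s′ , tt) ⇔
    (∃[ l ] s ≡ (l , n) ∷ s′ × m′ ≡ foldl code m l)
  run-call-guess = mk⇔ call⁻ call⁺
    where
    call⁻ : ∀ {m m′ s s′ n} → Run (cell ∷ tapes) ⊢call-guess (m , s , tt) n (m′ , s′ , tt) →
            ∃[ l ] s ≡ (l , n) ∷ s′ × m′ ≡ foldl code m l
    call⁻ (run {t ∷ _ ∷ []} (l , ts , refl , es , eq) (m , e , _)) =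
      l , e , guesses⁻ es (subst (λ t → Moves* (cell ∷ []) _ t _) eq (m , tt))

    call⁺ : ∀ {m m′ s s′ n} → ∃[ l ] s ≡ (l , n) ∷ s′ × m′ ≡ foldl code m l →
            Run (cell ∷ tapes) ⊢call-guess (m , s , tt) n (m′ , s′ , tt)
    -- Generalising `concat ts` exposes its one component, while `eq` remembers where it came from.
    call⁺ (l , refl , refl) with ts , es , ms ← guesses⁺ l with concat ts in eq | ms
    ... | t ∷ [] | m , _ =
      run {trace = t ∷ _ ∷ []} (l , ts , refl , es , sym eq) (m , refl , tt)

  ⊢sec-body : (4 , nat ⊸ nat) ∷ [] ⊢
              new 0 (seq (pushᵗ (` 4 · guessᵗ {ops})) (deref (` 0))) ∶ nat
  ⊢sec-body = ⊢new (inj₂ refl)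
    (⊢seq nat (⊢push u₄ ⊢call-guess) (⊢deref (⊢head (tail-unique u₄))))

  run-sec : ∀ {s k} → Run tapes ⊢sec-body (s , tt) k ([] , tt) ⇔
            (∃[ a ] s ≡ [ a ] × k ≡ code (codes (proj₁ a)) (proj₂ a))
  run-sec = mk⇔ sec⁻ sec⁺
    where
    sec⁻ : ∀ {s k} → Run tapes ⊢sec-body (s , tt) k ([] , tt) →
           ∃[ a ] s ≡ [ a ] × k ≡ code (codes (proj₁ a)) (proj₂ a)
    sec⁻ r
      with _ , r ← to run-new r
      with _ , r₁ , r₂ ← to run-seq r
      with refl , refl ← pure⁻ (pure-deref ref-head) r₂
      with _ , n , r₃ , e ← to (run-push u₄) r₁
      with l , e′ , refl ← to run-call-guess r₃ = (l , n) , e′ , e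

    sec⁺ : ∀ {s k} → ∃[ a ] s ≡ [ a ] × k ≡ code (codes (proj₁ a)) (proj₂ a) →
           Run tapes ⊢sec-body (s , tt) k ([] , tt)
    sec⁺ ((l , n) , e , e′) = from run-new (_ , from run-seq
      ( _ , from (run-push u₄) (_ , n , from run-call-guess (l , e , refl) , e′)
      , pure⁺ (pure-deref ref-head) refl))

  -- With `random` as guard the loop may run any number of times, so an argument list of any length
  -- can be recorded.
  ⊢reads : (0 , var) ∷ (3 , nat) ∷ (4 , nat) ∷ [] ⊢ while random (pushᵗ {ops} (` 3)) ∶ comm
  ⊢reads = ⊢while (⊢random (tail-unique u₃₄)) (⊢push u₃₄ ⊢z)

  run-reads : ∀ {m m′ s s′ t t′} →
              Run (cell ∷ tapes) ⊢reads (m , s , t , tt) tt (m′ , s′ , t′ , tt) ⇔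
              (∃[ l ] s ≡ l ++ s′ × t ≡ t′ × m′ ≡ foldl code m l)
  run-reads = mk⇔ (loop⁻ ∘ run-while⁻) (λ (l , e , e′ , e″) → run-while⁺ (loop⁺ l e e′ e″))
    where
    loop⁻ : ∀ {m m′ s s′ t t′} →
            Loop (cell ∷ tapes) (⊢random (tail-unique u₃₄)) (⊢push u₃₄ (⊢z {nat} {ops}))
              (m , s , t , tt) (m′ , s′ , t′ , tt) →
            ∃[ l ] s ≡ l ++ s′ × t ≡ t′ × m′ ≡ foldl code m l
    loop⁻ (stop _ r) with refl ← to run-random r = [] , refl , refl , refl
    loop⁻ (again r r′ lp)
      with refl ← to run-random r
      with _ , n , r″ , refl ← to (run-push u₃₄) r′
      with refl , refl , refl ← to run-z r″
      with l , e , e′ , e″ ← loop⁻ lp = n ∷ l , cong (n ∷_) e , e′ , e″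

    loop⁺ : ∀ l {m m′ s s′ t t′} → s ≡ l ++ s′ → t ≡ t′ → m′ ≡ foldl code m l →
            Loop (cell ∷ tapes) (⊢random (tail-unique u₃₄)) (⊢push u₃₄ (⊢z {nat} {ops}))
              (m , s , t , tt) (m′ , s′ , t′ , tt)
    loop⁺ []      refl refl refl = stop (λ ()) (from (run-random {n = 1}) refl)
    loop⁺ (n ∷ l) refl refl refl = again (from run-random refl)
      (from (run-push u₃₄) (_ , n , from run-z (refl , refl , refl) , refl))
      (loop⁺ l refl refl refl)

  ⊢ret-body : (3 , nat) ∷ (4 , nat) ∷ [] ⊢
              new 0 (seq (while random (pushᵗ (` 3))) (confirmᵗ {ops} (` 4))) ∶ nat
  ⊢ret-body = ⊢new (inj₂ refl) (⊢seq nat ⊢reads (⊢confirm u₂₃₄ u₃₄ ⊢y))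

  -- The argument tape has to end empty and only the loop reads it, so the loop records all of `l`
  -- before the result is guessed.
  run-ret : ∀ {l t n} → Run tapes ⊢ret-body (l , t , tt) n ([] , [] , tt) ⇔
            t ≡ [ code (codes l) n ]
  run-ret = mk⇔ ret⁻ ret⁺
    where
    ret⁻ : ∀ {l t n} → Run tapes ⊢ret-body (l , t , tt) n ([] , [] , tt) →
           t ≡ [ code (codes l) n ]
    ret⁻ r
      with _ , r ← to run-new r
      with _ , r₁ , r₂ ← to run-seq r
      with l , refl , refl , refl ← to run-reads r₁
      with refl , refl , e ← to run-y (to (run-confirm u₂₃₄ u₃₄) r₂)
      rewrite ++-identityʳ l = e

    ret⁺ : ∀ {l t n} → t ≡ [ code (codes l) n ] →
           Run tapes ⊢ret-body (l , t , tt) n ([] , [] , tt)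
    ret⁺ {l} e = from run-new (_ , from run-seq
      ( _ , from run-reads (l , sym (++-identityʳ l) , refl , refl)
      , from (run-confirm u₂₃₄ u₃₄) (from run-y (refl , refl , e))))

  function-retract : Retract ops (nat ⊸ nat) nat
  function-retract = record
    { Code       = λ (l , n) k → k ≡ code (codes l) n
    ; total      = λ _ → _ , refl
    ; injective  = λ {(l , n)} {(l′ , n′)} e e′ →
        let eq , eq′ = code-injective (codes l) (codes l′) n n′ (trans (sym e) e′)
        in cong₂ _,_ (codes-injective eq) eq′
    ; ⊢sec       = ⊢ƛ ⊢sec-body
    ; ⊢ret       = ⊢ƛ (⊢ƛ ⊢ret-body)
    ; sec-linear = linear-run run-sec
    ; ret-linear = linear (mk⇔
        (λ ds → _ , to run-ret (to denotes⇔run ds) , refl)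
        (λ { (_ , e , refl) → from denotes⇔run (from run-ret e) }))
    }

-- All types, and the passage to morphisms of free monoids.

retract : ∀ A → Retract ops A nat
retract nat     = nat-retract
retract comm    = comm-retract
retract var     = VarRetract.var-retract
retract (A ⊸ B) = FunctionRetract.function-retract ⊚ arrow (retract A) (retract B)

module _ {X Y : Set} {P : List X → Y → Set} {R : X → Y → Set}
         (P⇔R : ∀ {s y} → P s y ⇔ (∃[ x ] s ≡ [ x ] × R x y)) where

  -- Since each generator is related to one-letter words only, a word has to be factored into its
  -- letters.
  extend⁻ : ∀ {s ys} → MonRel.rel (extend (Free X) P) s ys → Pointwise R s ys
  extend⁻ (_ , []     , refl) = []
  extend⁻ (_ , p ∷ ps , refl) with _ , refl , r ← to P⇔R p = r ∷ extend⁻ (_ , ps , refl)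

  extend⁺ : ∀ {s ys} → Pointwise R s ys → MonRel.rel (extend (Free X) P) s ys
  extend⁺ []       = _ , [] , refl
  extend⁺ (r ∷ rs) with _ , ps , refl ← extend⁺ rs = _ , from P⇔R (_ , refl , r) ∷ ps , refl

theorem7p2 : (ops : Operations) (A : Ty) (x y : Id) →
    Σ[ inᵗ ∈ Term ops ] Σ[ outᵗ ∈ Term ops ]
    Σ[ ⊢in ∈ ((x , A) ∷ [] ⊢ inᵗ ∶ nat) ] Σ[ ⊢out ∈ ((y , nat) ∷ [] ⊢ outᵗ ∶ A) ]
    ⟦ ⊢in ⟧ᴹ ⨾ ⟦ ⊢out ⟧ᴹ ≈ idᴹ (Free (α A))
theorem7p2 ops A x y =
  _ , _ , ⊢apply (⊢sec r) ⊢var , ⊢apply (⊢ret r) ⊢var , λ as as′ → mk⇔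
    -- The intermediate sequence codes both `as` and `as′` letter by letter.
    (λ (_ , p , q) → injective* r (extend⁻ in⇔ p) (extend⁻ out⇔ q))
    -- Totality provides an intermediate sequence of codes.
    (λ { refl → let ns , ps = total* r as
                in ns , extend⁺ in⇔ ps , extend⁺ out⇔ (symmetric (λ p → p) ps) })
  where
  r : Retract ops A nat
  r = retract A

  in⇔ : ∀ {s n} → ⟦ ⊢apply (⊢sec r) (⊢var {x = x}) ⟧ (s ∷ []) n ⇔ (∃[ a ] s ≡ [ a ] × Code r a n)
  in⇔ = mk⇔ (apply⁻ (sec-linear r) ⊢var (_ ∷ [])) (apply⁺ (sec-linear r) ⊢var (_ ∷ []))

  out⇔ : ∀ {s a} → ⟦ ⊢apply (⊢ret r) (⊢var {x = y}) ⟧ (s ∷ []) a ⇔ (∃[ n ] s ≡ [ n ] × Code r a n)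
  out⇔ = mk⇔ (apply⁻ (ret-linear r) ⊢var (_ ∷ [])) (apply⁺ (ret-linear r) ⊢var (_ ∷ []))
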